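{- Let $q$ be a prime power. For any finite set $A\subset\mathbb{F}_q((t^{ -1}))$ and any $\epsilon>0$, \[ |A+A-A|^3\,|AA|^4 \gg_\epsilon q^{ -2}|A|^{9-\epsilon}, \] where the implied constant depends only on $\epsilon$.
   Context: $\mathbb{F}_q((t^{ -1}))$ is the field of formal Laurent series $\sum_{i=-\infty}^k\alpha_it^i$ with $\alpha_i\in\mathbb{F}_q$. $A+A-A=\{a+a'-a'':a,a',a''\in A\}$ and $AA=\{aa':a,a'\in A\}$. The notation $X\gg_\epsilon Y$ means $X\ge c(\epsilon)Y$ for a constant $c(\epsilon)>0$ depending only on $\epsilon$. -}

module Defs where

open import Level using (0ℓ)
open import Algebra.Bundles using (CommutativeRing)
open import Data.Nat as ℕ using (ℕ; zero; suc; _^_; _≥_)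
open import Data.Nat.Primality using (Prime)
open import Data.Integer as ℤ using (ℤ; +_; -[1+_]; _⊔_)
open import Data.Fin using (Fin)
open import Data.Product using (Σ; ∃; _×_; _,_)
open import Data.List using (List; length)
open import Data.List.Membership.Propositional using (_∈_)
open import Data.List.Relation.Unary.All using (All)
open import Data.List.Relation.Unary.Any using (Any)
open import Data.List.Relation.Unary.AllPairs using (AllPairs)
open import Function.Bundles using (Bijection)
open import Relation.Nullary using (¬_)
import Relation.Binary.PropositionalEquality as ≡
open ≡ using (_≡_)

IsPrimePower : ℕ → Set
IsPrimePower q = Σ ℕ λ p → Σ ℕ λ k → Prime p × k ≥ 1 × q ≡ p ^ k

record Field : Set₁ where
  field
    commRing : CommutativeRing 0ℓ 0ℓ
  open CommutativeRing commRing public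
  field
    1≉0     : ¬ (1# ≈ 0#)
    inverse : ∀ x → ¬ (x ≈ 0#) → Σ Carrier λ y → (x * y) ≈ 1#

record FiniteField (q : ℕ) : Set₁ where
  field
    field′ : Field
  open Field field′ public
  field
    enumeration : Bijection (≡.setoid (Fin q)) setoid

-- Formal Laurent series in t⁻¹ over a field F:
-- a pair (k , f) represents  Σ_{j ≥ 0} f j · t^(k - j).
module Laurent (F : Field) where
  open Field F using (Carrier; 0#) renaming (_+_ to _+F_; _*_ to _*F_; -_ to -F_; _≈_ to _≈F_)

  record LS : Set where
    constructor ls
    field
      top  : ℤ
      cofs : ℕ → Carrier
  open LS public

  coeff : LS → ℤ → Carrier
  coeff (ls k f) i with k ℤ.- i
  ... | + n      = f n
  ... | -[1+ _ ] = 0#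

  sumBelow : (ℕ → Carrier) → ℕ → Carrier
  sumBelow g zero    = 0#
  sumBelow g (suc m) = sumBelow g m +F g m

  infix  4 _≈_
  infixl 6 _+_ _-_
  infixl 7 _*_

  _≈_ : LS → LS → Set
  x ≈ y = ∀ i → coeff x i ≈F coeff y i

  _≉_ : LS → LS → Set
  x ≉ y = ¬ (x ≈ y)

  _+_ : LS → LS → LS
  x + y = ls K (λ j → coeff x (K ℤ.- + j) +F coeff y (K ℤ.- + j))
    where K = top x ⊔ top y

  -_ : LS → LS
  - ls k f = ls k (λ j → -F f j)

  _-_ : LS → LS → LS
  x - y = x + (- y)

  _*_ : LS → LS → LS
  ls k f * ls l g = ls (k ℤ.+ l) (λ n → sumBelow (λ j → f j *F g (n ℕ.∸ j)) (suc n))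

  IsFinSet : List LS → Set
  IsFinSet A = AllPairs _≉_ A

  HasCard : (LS → Set) → ℕ → Set
  HasCard P m = Σ (List LS) λ L →
    length L ≡ m × AllPairs _≉_ L × All P L × (∀ x → P x → Any (x ≈_) L)

  InSumDiff : List LS → LS → Set
  InSumDiff A x = ∃ λ a → ∃ λ a′ → ∃ λ a″ →
    a ∈ A × a′ ∈ A × a″ ∈ A × x ≈ a + a′ - a″

  InProd : List LS → LS → Set
  InProd A x = ∃ λ a → ∃ λ a′ → a ∈ A × a′ ∈ A × x ≈ a * a′

{-# OPTIONS --safe #-}

-- Let n = |A|, p = |AA|, s = |A + A - A|, let ρ a be the degree of the distance from a to the rest
-- of A, and let κ be the largest number of a ∈ A such that a given x ∈ AA lies in the dilated ball
-- of degree ρ a + deg b around a b, for some fixed b ≠ 0.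
--
-- (1) n⁴ ≪ κ p² s. Double counting shows that for each b most of these balls contain O(κ p / n)
-- elements of AA, so only O(κ p² / n) pairs in AA² lie in a common such ball. Take tuples
-- (b, a, a′, c) with a′ ≠ a in the ball of degree ρ a around a, and send them to
-- (a b, a′ b, c + a - a′). The map is injective when c is determined by its ball of degree ρ a:
-- either ρ a < ρ c, or ρ takes one value r on half of A and c runs over representatives of the
-- balls of degree r. In both cases there are ≫ n³ tuples; the second uses Cauchy–Schwarz.
--
-- (2) n κ² ≪ q² L² s with L = 1 + ⌊log₂ s⌋. Let Q be a set of κ such elements a, and let u ∈ Q
-- minimise ρ. Let X ⊆ Y and X + Q - u ⊆ Y. A shift z ↦ z + a - u moves z by exactly degree ρ a, so
-- at z or at its image the number of points of Y in a ball halves on passing from degree ρ a to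
-- ρ a - 1. At each point this happens for at most L degrees, each shared by at most q elements
-- of Q. Hence |X| (κ - 1) ≤ 2 q L |Y|, which is applied to 2u - A ⊆ u + Q - A ⊆ A + A - A.
--
-- Together n⁹ ≪ q² L² s³ p⁴, where L is O(log n) unless s ≥ n³, in which case n⁹ ≤ s³.

module Submission where

-- A large `κ` weakens (1) and strengthens (2). Squaring (1) and multiplying by (2) removes `κ`, and
-- this fixes the exponents 3 and 4. A large `κ` forces additive growth because the distance is
-- ultrametric: balls that share a point are nested, so the elements of `Q` differ from `u` at
-- varying degrees, with boundedly many per degree, and differences of distinct degrees cannot
-- cancel, much like digits in distinct positions.
--
-- Equality of Laurent series is undecidable, and the degree of a nonzero series cannot be computed
-- by a search with a known bound. Closeness up to a given degree is decidable, since only finitely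
-- many higher coefficients can be nonzero. All counting is therefore done on index types `Fin n`,
-- and both (1) and (2) see the series only through their balls and a few relations between indices.

module FiniteSums where

  open import Data.Empty using (⊥; ⊥-elim)
  open import Data.Fin as Fin using (Fin)
  import Data.Fin.Properties as Fin
  open import Data.List using (List; []; _∷_; length; allFin; cartesianProduct; map; _++_)
  open import Data.List.Properties using (length-tabulate)
  open import Data.List.Membership.Propositional using (_∈_)
  open import Data.List.Membership.Propositional.Properties using (∈-allFin; ∈-cartesianProduct⁺)
  open import Data.List.Relation.Unary.All as All using (All; []; _∷_)
  open import Data.List.Relation.Unary.AllPairs using ([]; _∷_)
  open import Data.List.Relation.Unary.Any as Any using (here; there)
  open import Data.List.Relation.Unary.Unique.Propositional using (Unique)
  open import Data.List.Relation.Unary.Unique.Propositional.Properties using (allFin⁺; cartesianProduct⁺)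
  open import Data.Nat using (ℕ; suc; _+_; _*_; _≤_; _<_; z≤n; s≤s; _≟_)
  open import Data.Nat.Properties hiding (_≟_)
  open import Algebra.Properties.CommutativeSemigroup +-commutativeSemigroup using (interchange)
  open import Data.Product using (∃; _×_; _,_)
  open import Data.Product.Properties using (≡-dec)
  open import Data.Sum using (_⊎_; inj₁; inj₂)
  open import Function using (_∘_; id)
  open import Relation.Binary using (DecidableEquality)
  open import Relation.Binary.PropositionalEquality
  open import Relation.Nullary using (¬_; Dec; yes; no)
  open import Relation.Nullary.Decidable using (map′; _×-dec_; ¬?)
  open import Relation.Unary using (Decidable)

  -- Counting on finite types with decidable equality.

  record Finite (X : Set) : Set where
    field
      elems    : List X
      unique   : Unique elems
      complete : ∀ x → x ∈ elems
      dec≡     : DecidableEquality X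

  open Finite {{...}} public

  instance
    finite-Fin : ∀ {n} → Finite (Fin n)
    finite-Fin = record
      { elems = allFin _ ; unique = allFin⁺ _ ; complete = ∈-allFin ; dec≡ = Fin._≟_ }

    finite-× : ∀ {X Y} → {{Finite X}} → {{Finite Y}} → Finite (X × Y)
    finite-× = record
      { elems    = cartesianProduct elems elems
      ; unique   = cartesianProduct⁺ unique unique
      ; complete = λ (x , y) → ∈-cartesianProduct⁺ (complete x) (complete y)
      ; dec≡     = ≡-dec dec≡ dec≡ }

  𝟙 : ∀ {P : Set} → Dec P → ℕ
  𝟙 (yes _) = 1
  𝟙 (no _)  = 0

  𝟙≤1 : ∀ {P : Set} (d : Dec P) → 𝟙 d ≤ 1
  𝟙≤1 (yes _) = ≤-refl
  𝟙≤1 (no _)  = z≤n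

  𝟙-≤ : ∀ {P : Set} {m} (d : Dec P) → (P → 1 ≤ m) → 𝟙 d ≤ m
  𝟙-≤ (yes p) h = h p
  𝟙-≤ (no _)  h = z≤n

  𝟙-≥ : ∀ {P : Set} (d : Dec P) → P → 1 ≤ 𝟙 d
  𝟙-≥ (yes _) p = ≤-refl
  𝟙-≥ (no ¬p) p = ⊥-elim (¬p p)

  𝟙*-≤ : ∀ {P : Set} {k m} (d : Dec P) → (P → k ≤ m) → 𝟙 d * k ≤ m
  𝟙*-≤ {k = k} (yes p) h = ≤-trans (≤-reflexive (+-identityʳ k)) (h p)
  𝟙*-≤         (no _)  h = z≤n

  ≤-𝟙-split : ∀ {P : Set} {k x y} (d : Dec P) → (P → k ≤ x) → (¬ P → k ≤ y) →
              k ≤ 𝟙 d * x + 𝟙 (¬? d) * y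
  ≤-𝟙-split {x = x} (yes p) h _ = ≤-trans (h p) (≤-trans (m≤m+n x 0) (m≤m+n _ 0))
  ≤-𝟙-split {y = y} (no ¬p) _ h = ≤-trans (h ¬p) (m≤m+n y 0)

  𝟙-disjoint : ∀ {P Q R : Set} (d : Dec P) (e : Dec Q) (f : Dec R) →
               (P → Q → ⊥) → (P → R) → (Q → R) → 𝟙 d + 𝟙 e ≤ 𝟙 f
  𝟙-disjoint (yes p) (yes q) f no-both _ _ = ⊥-elim (no-both p q)
  𝟙-disjoint (yes p) (no _)  f _ h _       = 𝟙-≥ f (h p)
  𝟙-disjoint (no _)  e       f _ _ h       = 𝟙-≤ e (𝟙-≥ f ∘ h)

  𝟙-union : ∀ {P Q R : Set} (d : Dec P) (e : Dec Q) (f : Dec R) →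
            (R → P ⊎ Q) → 𝟙 f ≤ 𝟙 d + 𝟙 e
  𝟙-union d e f h = 𝟙-≤ f (λ r → case (h r))
    where
    case : _ → 1 ≤ 𝟙 d + 𝟙 e
    case (inj₁ p) = ≤-trans (𝟙-≥ d p) (m≤m+n _ _)
    case (inj₂ q) = ≤-trans (𝟙-≥ e q) (m≤n+m _ (𝟙 d))

  𝟙-mono : ∀ {P Q : Set} (d : Dec P) (e : Dec Q) → (P → Q) → 𝟙 d ≤ 𝟙 e
  𝟙-mono d e h = 𝟙-≤ d (𝟙-≥ e ∘ h)

  𝟙≢0 : ∀ {P : Set} (d : Dec P) → 𝟙 d ≢ 0 → P
  𝟙≢0 (yes p) _ = p
  𝟙≢0 (no _)  h = ⊥-elim (h refl)

  𝟙-× : ∀ {P Q : Set} (d : Dec P) (e : Dec Q) → 𝟙 (d ×-dec e) ≡ 𝟙 d * 𝟙 e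
  𝟙-× (yes _) (yes _) = refl
  𝟙-× (yes _) (no _)  = refl
  𝟙-× (no _)  (yes _) = refl
  𝟙-× (no _)  (no _)  = refl

  module _ {X : Set} where

    sumₗ : (X → ℕ) → List X → ℕ
    sumₗ f []       = 0
    sumₗ f (x ∷ xs) = f x + sumₗ f xs

    sumₗ-mono : ∀ {f g} → (∀ x → f x ≤ g x) → ∀ xs → sumₗ f xs ≤ sumₗ g xs
    sumₗ-mono h []       = z≤n
    sumₗ-mono h (x ∷ xs) = +-mono-≤ (h x) (sumₗ-mono h xs)

    sumₗ-+ : ∀ f g xs → sumₗ (λ x → f x + g x) xs ≡ sumₗ f xs + sumₗ g xs
    sumₗ-+ f g []       = refl
    sumₗ-+ f g (x ∷ xs) = trans (cong (f x + g x +_) (sumₗ-+ f g xs))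
                                (interchange (f x) (g x) _ _)

    sumₗ-*ˡ : ∀ c f xs → sumₗ (λ x → c * f x) xs ≡ c * sumₗ f xs
    sumₗ-*ˡ c f []       = sym (*-zeroʳ c)
    sumₗ-*ˡ c f (x ∷ xs) = trans (cong (c * f x +_) (sumₗ-*ˡ c f xs))
                                 (sym (*-distribˡ-+ c (f x) _))

    sumₗ-const : ∀ c xs → sumₗ (λ _ → c) xs ≡ length xs * c
    sumₗ-const c []       = refl
    sumₗ-const c (x ∷ xs) = cong (c +_) (sumₗ-const c xs)

    sumₗ-zero : ∀ f xs → All (λ x → f x ≡ 0) xs → sumₗ f xs ≡ 0
    sumₗ-zero f []       []       = refl
    sumₗ-zero f (x ∷ xs) (p ∷ ps) = cong₂ _+_ p (sumₗ-zero f xs ps)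

    sumₗ-term : ∀ f {x} xs → x ∈ xs → f x ≤ sumₗ f xs
    sumₗ-term f (x ∷ xs) (here refl) = m≤m+n (f x) _
    sumₗ-term f (x ∷ xs) (there h)   = ≤-trans (sumₗ-term f xs h) (m≤n+m _ (f x))

    sumₗ-single : ∀ f m → (∀ x → f x ≤ m) → (∀ x y → f x ≢ 0 → f y ≢ 0 → x ≡ y) →
                  ∀ xs → Unique xs → sumₗ f xs ≤ m
    sumₗ-single f m b u []       []       = z≤n
    sumₗ-single f m b u (x ∷ xs) (p ∷ ps) with f x ≟ 0
    ... | yes e rewrite e = sumₗ-single f m b u xs ps
    ... | no ¬e = begin
      f x + sumₗ f xs ≡⟨ cong (f x +_) (sumₗ-zero f xs (All.map others p)) ⟩
      f x + 0         ≡⟨ +-identityʳ _ ⟩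
      f x             ≤⟨ b x ⟩
      m               ∎
      where
      open ≤-Reasoning
      others : ∀ {y} → x ≢ y → f y ≡ 0
      others {y} x≢y with f y ≟ 0
      ... | yes e  = e
      ... | no ¬e′ = ⊥-elim (x≢y (u x y ¬e ¬e′))

    sumₗ-pigeonhole : ∀ f c xs → length xs * c < sumₗ f xs → ∃ λ x → c < f x
    sumₗ-pigeonhole f c (x ∷ xs) h with c <? f x
    ... | yes c<fx = x , c<fx
    ... | no  c≮fx = sumₗ-pigeonhole f c xs
      (+-cancelˡ-< c _ _ (<-≤-trans h (+-monoˡ-≤ _ (≮⇒≥ c≮fx))))

    sumₗ-++ : ∀ f xs ys → sumₗ f (xs ++ ys) ≡ sumₗ f xs + sumₗ f ys
    sumₗ-++ f []       ys = refl
    sumₗ-++ f (x ∷ xs) ys = trans (cong (f x +_) (sumₗ-++ f xs ys)) (sym (+-assoc (f x) _ _))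

  sumₗ-map : ∀ {X Y : Set} (f : Y → ℕ) (g : X → Y) xs → sumₗ f (map g xs) ≡ sumₗ (f ∘ g) xs
  sumₗ-map f g []       = refl
  sumₗ-map f g (x ∷ xs) = cong (f (g x) +_) (sumₗ-map f g xs)

  sumₗ-swap : ∀ {X Y : Set} (f : X → Y → ℕ) xs ys →
              sumₗ (λ x → sumₗ (f x) ys) xs ≡ sumₗ (λ y → sumₗ (λ x → f x y) xs) ys
  sumₗ-swap f []       ys = sym (sumₗ-zero _ ys (All.universal (λ _ → refl) ys))
  sumₗ-swap f (x ∷ xs) ys = trans (cong (sumₗ (f x) ys +_) (sumₗ-swap f xs ys))
                                  (sym (sumₗ-+ (f x) _ ys))

  sumₗ-× : ∀ {X Y : Set} (f : X × Y → ℕ) xs ys →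
           sumₗ f (cartesianProduct xs ys) ≡ sumₗ (λ x → sumₗ (λ y → f (x , y)) ys) xs
  sumₗ-× f []       ys = refl
  sumₗ-× f (x ∷ xs) ys = trans (sumₗ-++ f (map (x ,_) ys) _)
                               (cong₂ _+_ (sumₗ-map f (x ,_) ys) (sumₗ-× f xs ys))

  ∑ : ∀ {X} → {{Finite X}} → (X → ℕ) → ℕ
  ∑ f = sumₗ f elems

  card : ∀ X → {{Finite X}} → ℕ
  card X = length (elems {X})

  count : ∀ {X} → {{Finite X}} → {P : X → Set} → Decidable P → ℕ
  count P? = ∑ (λ x → 𝟙 (P? x))

  card-Fin : ∀ n → card (Fin n) ≡ n
  card-Fin n = length-tabulate {n = n} id

  module _ {X : Set} {{_ : Finite X}} where

    ∑-mono : {f g : X → ℕ} → (∀ x → f x ≤ g x) → ∑ f ≤ ∑ g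
    ∑-mono h = sumₗ-mono h elems

    ∑-cong : {f g : X → ℕ} → (∀ x → f x ≡ g x) → ∑ f ≡ ∑ g
    ∑-cong h = ≤-antisym (∑-mono (≤-reflexive ∘ h)) (∑-mono (≤-reflexive ∘ sym ∘ h))

    ∑-+ : (f g : X → ℕ) → ∑ (λ x → f x + g x) ≡ ∑ f + ∑ g
    ∑-+ f g = sumₗ-+ f g elems

    ∑-*ˡ : ∀ c (f : X → ℕ) → ∑ (λ x → c * f x) ≡ c * ∑ f
    ∑-*ˡ c f = sumₗ-*ˡ c f elems

    ∑-*ʳ : ∀ c (f : X → ℕ) → ∑ (λ x → f x * c) ≡ ∑ f * c
    ∑-*ʳ c f = trans (∑-cong (λ x → *-comm (f x) c)) (trans (∑-*ˡ c f) (*-comm c (∑ f)))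

    ∑-const : ∀ c → ∑ {X} (λ _ → c) ≡ card X * c
    ∑-const c = sumₗ-const c (elems {X})

    ∑-bound : ∀ c {f : X → ℕ} → (∀ x → f x ≤ c) → ∑ f ≤ card X * c
    ∑-bound c h = ≤-trans (∑-mono h) (≤-reflexive (sumₗ-const c (elems {X})))

    ∑-term : (f : X → ℕ) → ∀ x → f x ≤ ∑ f
    ∑-term f x = sumₗ-term f elems (complete x)

    ∑-single : (f : X → ℕ) → ∀ m → (∀ x → f x ≤ m) →
               (∀ x y → f x ≢ 0 → f y ≢ 0 → x ≡ y) → ∑ f ≤ m
    ∑-single f m b u = sumₗ-single f m b u elems unique

    ∑-pigeonhole : ∀ (f : X → ℕ) c → card X * c < ∑ f → ∃ λ x → c < f x
    ∑-pigeonhole f c = sumₗ-pigeonhole f c elems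

    ∑-swap : ∀ {Y} {{_ : Finite Y}} (f : X → Y → ℕ) →
             ∑ (λ x → ∑ (f x)) ≡ ∑ (λ y → ∑ (λ x → f x y))
    ∑-swap f = sumₗ-swap f elems elems

    ∑-× : ∀ {Y} {{_ : Finite Y}} (f : X × Y → ℕ) → ∑ f ≡ ∑ (λ x → ∑ (λ y → f (x , y)))
    ∑-× f = sumₗ-× f elems elems

  Fin⇒1≤ : ∀ {m} → Fin m → 1 ≤ m
  Fin⇒1≤ {suc _} _ = s≤s z≤n

  card-× : ∀ X Y {{_ : Finite X}} {{_ : Finite Y}} → card (X × Y) ≡ card X * card Y
  card-× X Y = begin
    card (X × Y)                                  ≡⟨ *-identityʳ _ ⟨
    card (X × Y) * 1                              ≡⟨ sumₗ-const 1 (elems {X × Y}) ⟨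
    sumₗ (λ _ → 1) (elems {X × Y})                ≡⟨ sumₗ-× (λ _ → 1) (elems {X}) (elems {Y}) ⟩
    sumₗ (λ _ → sumₗ (λ _ → 1) (elems {Y})) (elems {X}) ≡⟨ sumₗ-const _ (elems {X}) ⟩
    card X * sumₗ (λ _ → 1) (elems {Y})           ≡⟨ cong (card X *_) (sumₗ-const 1 (elems {Y})) ⟩
    card X * (card Y * 1)                         ≡⟨ cong (card X *_) (*-identityʳ _) ⟩
    card X * card Y                               ∎
    where open ≡-Reasoning

  module _ {X : Set} {{_ : Finite X}} where

    count-mono : {P Q : X → Set} (P? : Decidable P) (Q? : Decidable Q) →
                 (∀ {x} → P x → Q x) → count P? ≤ count Q?
    count-mono P? Q? h = ∑-mono (λ x → 𝟙-mono (P? x) (Q? x) h)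

    count≤card : {P : X → Set} (P? : Decidable P) → count P? ≤ card X
    count≤card P? = ≤-trans (∑-bound 1 (λ x → 𝟙≤1 (P? x))) (≤-reflexive (*-identityʳ _))

    count>0 : {P : X → Set} (P? : Decidable P) → ∀ {x} → P x → 1 ≤ count P?
    count>0 P? {x} p = ≤-trans (𝟙-≥ (P? x) p) (∑-term (λ x → 𝟙 (P? x)) x)

    count-single : {P : X → Set} (P? : Decidable P) → (∀ {x y} → P x → P y → x ≡ y) → count P? ≤ 1
    count-single P? u = ∑-single _ 1 (λ x → 𝟙≤1 (P? x))
      (λ x y p q → u (𝟙≢0 (P? x) p) (𝟙≢0 (P? y) q))

  module _ {X : Set} {{_ : Finite X}} where

    -- The graph of `f` is counted both ways: each `x` in `P` has a point over it, and over each `y`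
    -- injectivity on `P` leaves at most one point, and none unless `Q y`.
    count-inj : ∀ {Y} {{_ : Finite Y}} {P : X → Set} {Q : Y → Set}
                (P? : Decidable P) (Q? : Decidable Q) (f : X → Y) →
                (∀ {x} → P x → Q (f x)) →
                (∀ {x x′} → P x → P x′ → f x ≡ f x′ → x ≡ x′) →
                count P? ≤ count Q?
    count-inj P? Q? f pq inj = begin
      ∑ (λ x → 𝟙 (P? x))
        ≤⟨ ∑-mono (λ x → 𝟙-≤ (P? x) (λ p → count>0 (λ y → P? x ×-dec dec≡ (f x) y) (p , refl))) ⟩
      ∑ (λ x → ∑ (λ y → 𝟙 (P? x ×-dec dec≡ (f x) y)))
        ≡⟨ ∑-swap (λ x y → 𝟙 (P? x ×-dec dec≡ (f x) y)) ⟩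
      ∑ (λ y → ∑ (λ x → 𝟙 (P? x ×-dec dec≡ (f x) y)))
        ≤⟨ ∑-mono (λ y → ∑-single _ (𝟙 (Q? y))
             (λ x → 𝟙-mono (P? x ×-dec dec≡ (f x) y) (Q? y) λ { (p , refl) → pq p })
             (λ x x′ a b → let (p , e) = 𝟙≢0 (P? x ×-dec dec≡ (f x) y) a
                               (p′ , e′) = 𝟙≢0 (P? x′ ×-dec dec≡ (f x′) y) b
                           in inj p p′ (trans e (sym e′)))) ⟩
      ∑ (λ y → 𝟙 (Q? y)) ∎
      where open ≤-Reasoning

    any? : {P : X → Set} → Decidable P → Dec (∃ P)
    any? P? = map′ Any.satisfied (λ (x , p) → Any.map (λ { refl → p }) (complete x))
                   (Any.any? P? elems)

    all? : {P : X → Set} → Decidable P → Dec (∀ x → P x)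
    all? P? = map′ (λ ps x → All.lookup ps (complete x)) (λ h → All.universal h elems)
                   (All.all? P? elems)

    -- Finiteness lets double negations pass through the quantifier, so that finitely many degrees
    -- that merely cannot fail to exist become available all at once.
    ¬¬-∀ : {P : X → Set} → (∀ x → ¬ ¬ P x) → ¬ ¬ (∀ x → P x)
    ¬¬-∀ {P} h k = go elems (λ ps → k (λ x → All.lookup ps (complete x)))
      where
      go : ∀ xs → ¬ ¬ All P xs
      go []       k = k []
      go (x ∷ xs) k = h x (λ p → go xs (λ ps → k (p ∷ ps)))

    module _ {P : X → Set} (P? : Decidable P) (_≼_ : X → X → Set)
             (total : ∀ x y → x ≼ y ⊎ y ≼ x) (≼-trans : ∀ {x y z} → x ≼ y → y ≼ z → x ≼ z) where

      private
        leastₗ : ∀ xs → All (¬_ ∘ P) xs ⊎ (∃ λ x → P x × All (λ y → P y → x ≼ y) xs)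
        leastₗ [] = inj₁ []
        leastₗ (x ∷ xs) with P? x | leastₗ xs
        ... | no ¬p | inj₁ ps           = inj₁ (¬p ∷ ps)
        ... | no ¬p | inj₂ (m , pm , l) = inj₂ (m , pm , (⊥-elim ∘ ¬p) ∷ l)
        ... | yes p | inj₁ ps           =
          inj₂ (x , p , (λ _ → ≼-refl) ∷ All.map (λ ¬q q → ⊥-elim (¬q q)) ps)
          where
          ≼-refl : x ≼ x
          ≼-refl with total x x
          ... | inj₁ r = r
          ... | inj₂ r = r
        ... | yes p | inj₂ (m , pm , l) with total x m
        ...   | inj₁ x≼m = inj₂ (x , p , (λ _ → ≼-refl) ∷ All.map (λ f q → ≼-trans x≼m (f q)) l)
          where
          ≼-refl : x ≼ x
          ≼-refl with total x x
          ... | inj₁ r = r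
          ... | inj₂ r = r
        ...   | inj₂ m≼x = inj₂ (m , pm , (λ _ → m≼x) ∷ l)

      -- Any total transitive relation is allowed, so that maxima, such as the largest ball or `κ`,
      -- are least elements of a reversed order.
      least : ∃ P → ∃ λ x → P x × (∀ y → P y → x ≼ y)
      least (x , p) with leastₗ elems
      ... | inj₁ ps          = ⊥-elim (All.lookup ps (complete x) p)
      ... | inj₂ (m , q , l) = m , q , λ y → All.lookup l (complete y)

  ∑*∑ : ∀ {X Y} {{_ : Finite X}} {{_ : Finite Y}} (f : X → ℕ) (g : Y → ℕ) →
        ∑ f * ∑ g ≡ ∑ (λ x → ∑ (λ y → f x * g y))
  ∑*∑ f g = sym (trans (∑-cong (λ x → ∑-*ˡ (f x) g)) (∑-*ʳ (∑ g) f))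

-- Balls of an ultrametric, as nested equivalence relations.

module BallSystems where

  open import Data.Integer as ℤ using (ℤ)
  open import Relation.Nullary using (Dec)

  -- x ~[ r ] y says that y lies in the closed ball of degree r around x.
  record BallSystem (I : Set) : Set₁ where
    field
      _~[_]_  : I → ℤ → I → Set
      ~-dec   : ∀ x r y → Dec (x ~[ r ] y)
      ~-refl  : ∀ {r x} → x ~[ r ] x
      ~-sym   : ∀ {r x y} → x ~[ r ] y → y ~[ r ] x
      ~-trans : ∀ {r x y z} → x ~[ r ] y → y ~[ r ] z → x ~[ r ] z
      ~-mono  : ∀ {r r′ x y} → r ℤ.≤ r′ → x ~[ r ] y → x ~[ r′ ] y

-- Laurent series: coefficients, balls, products and degrees.

module LaurentSeries where

  open import Defs using (Field; module Laurent)
  open BallSystems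
  open import Data.Empty using (⊥-elim)
  open import Data.Fin as Fin using (Fin; toℕ; fromℕ<)
  import Data.Fin.Properties as Fin
  open import Data.Integer as ℤ using (ℤ; +_; -[1+_])
  import Data.Integer.Properties as ℤ
  open import Data.Integer.Tactic.RingSolver using (solve-∀)
  open import Data.Nat as ℕ using (ℕ; zero; suc; s≤s; z≤n)
  import Data.Nat.Properties as ℕ
  open import Data.Product using (∃; _×_; _,_; proj₁; proj₂)
  open import Data.Sum using (_⊎_; inj₁; inj₂)
  open import Function using (_∘_)
  open import Relation.Binary using (tri<; tri≈; tri>)
  import Relation.Binary.PropositionalEquality as ≡
  open ≡ using (_≡_; refl)
  import Relation.Binary.Reasoning.Setoid as SetoidReasoning
  open import Relation.Nullary using (¬_; Dec; yes; no)
  open import Relation.Nullary.Decidable using (map′; decidable-stable)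

  <⇒offset : ∀ {i j} → i ℤ.< j → ∃ λ n → j ≡ i ℤ.+ + suc n
  <⇒offset {i} {j} i<j = go (j ℤ.- i) refl
    where
    eq : ∀ i j → j ≡ i ℤ.+ (j ℤ.- i)
    eq = solve-∀
    go : ∀ d → j ℤ.- i ≡ d → ∃ λ n → j ≡ i ℤ.+ + suc n
    go (+ suc n)  e = n , ≡.trans (eq i j) (≡.cong (λ d → i ℤ.+ d) e)
    go (+ zero)   e = ⊥-elim (ℤ.<-irrefl (≡.sym (≡.trans (eq i j) (≡.trans (≡.cong (λ d → i ℤ.+ d) e) (ℤ.+-identityʳ i)))) i<j)
    go (-[1+ n ]) e = ⊥-elim (ℤ.<-asym i<j (≡.subst (ℤ._< i) (≡.sym (≡.trans (eq i j) (≡.cong (λ d → i ℤ.+ d) e)))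
      (≡.subst (i ℤ.+ -[1+ n ] ℤ.<_) (ℤ.+-identityʳ i) (ℤ.+-monoʳ-< i ℤ.-<+))))

  ≤⇒offset : ∀ {i j} → i ℤ.≤ j → ∃ λ n → j ≡ i ℤ.+ + n
  ≤⇒offset {i} {j} i≤j with ℤ.<-cmp i j
  ... | tri< lt _ _   = let (n , e) = <⇒offset lt in suc n , e
  ... | tri≈ _ refl _ = 0 , ≡.sym (ℤ.+-identityʳ i)
  ... | tri> _ _ gt   = ⊥-elim (ℤ.<⇒≱ gt i≤j)

  i<i+1+n : ∀ i n → i ℤ.< i ℤ.+ + suc n
  i<i+1+n i n = ≡.subst (ℤ._< i ℤ.+ + suc n) (ℤ.+-identityʳ i) (ℤ.+-monoʳ-< i (ℤ.+<+ (s≤s z≤n)))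

  i≤i+n : ∀ i n → i ℤ.≤ i ℤ.+ + n
  i≤i+n i n = ≡.subst (ℤ._≤ i ℤ.+ + n) (ℤ.+-identityʳ i) (ℤ.+-monoʳ-≤ i (ℤ.+≤+ z≤n))

  difference : ∀ {m n} → m ℕ.≤ n → ∃ λ d → d ℕ.+ m ≡ n
  difference {m} {n} m≤n = n ℕ.∸ m , ℕ.m∸n+n≡m m≤n

  exceed : ∀ e w → ∃ λ n → e ℤ.< w ℤ.+ + n
  exceed e w with ℤ.<-cmp e w
  ... | tri< lt _ _   = 0 , ≡.subst (e ℤ.<_) (≡.sym (ℤ.+-identityʳ w)) lt
  ... | tri≈ _ refl _ = 1 , i<i+1+n w 0
  ... | tri> _ _ gt with n , refl ← <⇒offset gt = suc (suc n) , ℤ.+-monoʳ-< w (ℤ.+<+ ℕ.≤-refl)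

  module Series (F : Field) (_≟F_ : ∀ x y → Dec (Field._≈_ F x y)) where

    open Field F hiding (refl) renaming (_≈_ to _≈F_)
    open Laurent F using (LS; ls; top; cofs; coeff; sumBelow)
    private
      module L = Laurent F
      module F = Field F

    coeff-at : ∀ x {i n} → top x ≡ i ℤ.+ + n → coeff x i ≡ cofs x n
    coeff-at (ls k f) {i} {n} e with k ℤ.- i | ≡.trans (≡.cong (ℤ._- i) e) (eq i (+ n))
      where
      eq : ∀ i n → i ℤ.+ n ℤ.- i ≡ n
      eq = solve-∀
    ... | _ | refl = refl

    coeff-above : ∀ x {i} → top x ℤ.< i → coeff x i ≡ 0#
    coeff-above (ls k f) {i} k<i with n , refl ← <⇒offset k<i
      with k ℤ.- (k ℤ.+ + suc n) | eq k (+ suc n)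
      where
      eq : ∀ k n → k ℤ.- (k ℤ.+ n) ≡ ℤ.- n
      eq = solve-∀
    ... | _ | refl = refl

    Vanish : LS → ℤ → Set
    Vanish x r = ∀ i → r ℤ.< i → coeff x i ≈F 0#

    vanish-top : ∀ x → Vanish x (top x)
    vanish-top x i lt = reflexive (coeff-above x lt)

    vanish-mono : ∀ x {r r′} → r ℤ.≤ r′ → Vanish x r → Vanish x r′
    vanish-mono x le v i lt = v i (ℤ.≤-<-trans le lt)

    ≤-or-above : ∀ i k → (∃ λ n → k ≡ i ℤ.+ + n) ⊎ k ℤ.< i
    ≤-or-above i k with ℤ.<-cmp i k
    ... | tri< lt _ _ = inj₁ (≤⇒offset (ℤ.<⇒≤ lt))
    ... | tri≈ _ e _  = inj₁ (≤⇒offset (ℤ.≤-reflexive e))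
    ... | tri> _ _ gt = inj₂ gt

    coeff-+ : ∀ x y i → coeff (x L.+ y) i ≈F coeff x i + coeff y i
    coeff-+ x y i with ≤-or-above i (top x ℤ.⊔ top y)
    ... | inj₁ (n , e) = trans (reflexive (coeff-at (x L.+ y) e))
                               (reflexive (≡.cong (λ j → coeff x j + coeff y j) (≡.trans (≡.cong (ℤ._- + n) e) (eq i (+ n)))))
      where
      eq : ∀ i n → i ℤ.+ n ℤ.- n ≡ i
      eq = solve-∀
    ... | inj₂ lt = trans (reflexive (coeff-above (x L.+ y) lt)) (sym (trans
      (+-cong (vanish-top x i (ℤ.≤-<-trans (ℤ.i≤i⊔j (top x) (top y)) lt))
              (vanish-top y i (ℤ.≤-<-trans (ℤ.i≤j⊔i (top x) (top y)) lt)))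
      (+-identityˡ 0#)))

    coeff-neg : ∀ x i → coeff (L.- x) i ≈F - coeff x i
    coeff-neg x i with ≤-or-above i (top x)
    ... | inj₁ (n , e) = reflexive (≡.trans (coeff-at (L.- x) e) (≡.cong -_ (≡.sym (coeff-at x e))))
    ... | inj₂ lt = trans (reflexive (coeff-above (L.- x) lt))
                          (trans (sym -0#≈0#) (-‿cong (sym (vanish-top x i lt))))
      where open import Algebra.Properties.Ring (F.ring) using (-0#≈0#)

    coeff-- : ∀ x y i → coeff (x L.- y) i ≈F coeff x i - coeff y i
    coeff-- x y i = trans (coeff-+ x (L.- y) i) (+-congˡ (coeff-neg y i))

    _~[_]_ : LS → ℤ → LS → Set
    x ~[ r ] y = ∀ i → r ℤ.< i → coeff x i ≈F coeff y i

    -- Both series vanish above the larger of their tops, so only finitely many exponents above `r`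
    -- have to be compared.
    ~-dec : ∀ x r y → Dec (x ~[ r ] y)
    ~-dec x r y with ≤-or-above r (top x ℤ.⊔ top y)
    ... | inj₂ lt = yes (λ i lt′ → trans
      (vanish-top x i (ℤ.≤-<-trans (ℤ.i≤i⊔j (top x) (top y)) (ℤ.<-trans lt lt′)))
      (sym (vanish-top y i (ℤ.≤-<-trans (ℤ.i≤j⊔i (top x) (top y)) (ℤ.<-trans lt lt′)))))
    ... | inj₁ (n , e) = map′ to from (Fin.all? (λ (j : Fin n) → coeff x (index j) ≟F coeff y (index j)))
      where
      index : Fin n → ℤ
      index j = r ℤ.+ + suc (toℕ j)
      to : (∀ j → coeff x (index j) ≈F coeff y (index j)) → x ~[ r ] y
      to h i lt with m , refl ← <⇒offset lt with m ℕ.<? n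
      ... | yes m<n = ≡.subst (λ m → coeff x (r ℤ.+ + suc m) ≈F coeff y (r ℤ.+ + suc m))
                              (Fin.toℕ-fromℕ< m<n) (h (fromℕ< m<n))
      ... | no m≮n = trans (vanish-top x _ (ℤ.≤-<-trans (ℤ.i≤i⊔j (top x) (top y)) above))
                           (sym (vanish-top y _ (ℤ.≤-<-trans (ℤ.i≤j⊔i (top x) (top y)) above)))
        where
        above : top x ℤ.⊔ top y ℤ.< r ℤ.+ + suc m
        above = ≡.subst (ℤ._< r ℤ.+ + suc m) (≡.sym e) (ℤ.+-monoʳ-< r (ℤ.+<+ (s≤s (ℕ.≮⇒≥ m≮n))))
      from : x ~[ r ] y → ∀ j → coeff x (index j) ≈F coeff y (index j)
      from h j = h (index j) (i<i+1+n r (toℕ j))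

    -- The coefficient at `r` labels the balls of degree `r - 1` inside one of degree `r`; this is
    -- the source of the factor `q`.
    ~-refine : ∀ {x y r} → x ~[ r ] y → coeff x r ≈F coeff y r → x ~[ ℤ.pred r ] y
    ~-refine {r = r} close e i lt with ℤ.<-cmp r i
    ... | tri< r<i _ _  = close i r<i
    ... | tri≈ _ refl _ = e
    ... | tri> _ _ i<r  = ⊥-elim (ℤ.<⇒≱ lt (ℤ.i<j⇒i≤pred[j] i<r))

    balls : ∀ {I : Set} → (I → LS) → BallSystem I
    balls X = record
      { _~[_]_  = λ x r y → X x ~[ r ] X y
      ; ~-dec   = λ x r y → ~-dec (X x) r (X y)
      ; ~-refl  = λ _ _ → F.refl
      ; ~-sym   = λ h i lt → sym (h i lt)
      ; ~-trans = λ h h′ i lt → trans (h i lt) (h′ i lt)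
      ; ~-mono  = λ le h i lt → h i (ℤ.≤-<-trans le lt) }

    -- d is the degree of x - y.
    Distance : LS → LS → ℤ → Set
    Distance x y d = ¬ (coeff x d ≈F coeff y d) × x ~[ d ] y

    -- Descending from the larger top, the first exponent with different coefficients would be the
    -- distance; if there is none, all coefficients agree. No bound on this search is known in
    -- advance, hence the double negation.
    distance : ∀ x y → ¬ (x L.≈ y) → ¬ ¬ (∃ (Distance x y))
    distance x y x≉y none = x≉y equal
      where
      T = top x ℤ.⊔ top y
      step : ∀ n → x ~[ T ℤ.- + n ] y
      step zero i lt = trans (vanish-top x i (ℤ.≤-<-trans (ℤ.i≤i⊔j (top x) (top y)) T<i))
                             (sym (vanish-top y i (ℤ.≤-<-trans (ℤ.i≤j⊔i (top x) (top y)) T<i)))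
        where
        T<i : T ℤ.< i
        T<i = ≡.subst (ℤ._< i) (ℤ.+-identityʳ T) lt
      step (suc n) i lt with ℤ.<-cmp (T ℤ.- + n) i
      ... | tri< lt′ _ _  = step n i lt′
      ... | tri≈ _ refl _ = decidable-stable (coeff x i ≟F coeff y i) (λ neq → none (i , neq , step n))
      ... | tri> _ _ gt   = ⊥-elim (ℤ.<⇒≱ lt (≡.subst (i ℤ.≤_) (eq T (+ n)) (ℤ.i<j⇒i≤pred[j] gt)))
        where
        eq : ∀ T n → ℤ.- + 1 ℤ.+ (T ℤ.- n) ≡ T ℤ.- (+ 1 ℤ.+ n)
        eq = solve-∀
      equal : x L.≈ y
      equal i with n , lt ← exceed T i = step n i
        (≡.subst (T ℤ.- + n ℤ.<_) (eq i (+ n)) (ℤ.+-monoˡ-< (ℤ.- + n) lt))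
        where
        eq : ∀ i n → i ℤ.+ n ℤ.- n ≡ i
        eq = solve-∀

    -- Products as convolutions over finite windows.

    open import Algebra.Properties.Ring F.ring using (-‿distribˡ-*; -‿distribʳ-*; -‿+-comm; -0#≈0#)
    open import Algebra.Properties.CommutativeSemigroup +-commutativeSemigroup using (interchange)
    open SetoidReasoning F.setoid

    sum-cong : ∀ {g h} n → (∀ j → j ℕ.< n → g j ≈F h j) → sumBelow g n ≈F sumBelow h n
    sum-cong zero    e = F.refl
    sum-cong (suc n) e = +-cong (sum-cong n (λ j lt → e j (ℕ.m≤n⇒m≤1+n lt))) (e n ℕ.≤-refl)

    sum-- : ∀ g h n → sumBelow (λ j → g j - h j) n ≈F sumBelow g n - sumBelow h n
    sum-- g h zero    = sym (-‿inverseʳ 0#)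
    sum-- g h (suc n) = begin
      sumBelow (λ j → g j - h j) n + (g n - h n)          ≈⟨ +-congʳ (sum-- g h n) ⟩
      (sumBelow g n - sumBelow h n) + (g n - h n)         ≈⟨ interchange _ _ _ _ ⟩
      (sumBelow g n + g n) + (- sumBelow h n + - h n)     ≈⟨ +-congˡ (-‿+-comm _ _) ⟩
      (sumBelow g n + g n) - (sumBelow h n + h n)         ∎

    sum-shift : ∀ g n → sumBelow g (suc n) ≈F g 0 + sumBelow (g ∘ suc) n
    sum-shift g zero    = +-comm _ _
    sum-shift g (suc n) = trans (+-congʳ (sum-shift g n)) (+-assoc _ _ _)

    -- A section of the Cauchy product for exponent `m`, with the starting exponent `K` free. The
    -- sum defining `*` starts at `top x`, which may differ between equal series, and sums can be
    -- compared termwise only over a common range.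
    conv : LS → LS → ℤ → ℤ → ℕ → Carrier
    conv x y m K = sumBelow (λ j → coeff x (K ℤ.- + j) * coeff y (m ℤ.- K ℤ.+ + j))

    conv-extend-top : ∀ {x y m K} → Vanish x K → ∀ d N → conv x y m (K ℤ.+ + d) (d ℕ.+ N) ≈F conv x y m K N
    conv-extend-top {x} {y} {m} {K} v zero N = reflexive (≡.cong (λ K → conv x y m K N) (ℤ.+-identityʳ K))
    conv-extend-top {x} {y} {m} {K} v (suc d) N = begin
      conv x y m (K ℤ.+ + suc d) (suc (d ℕ.+ N))
        ≈⟨ sum-shift _ (d ℕ.+ N) ⟩
      coeff x (K ℤ.+ + suc d ℤ.- + 0) * coeff y (m ℤ.- (K ℤ.+ + suc d) ℤ.+ + 0)
        + sumBelow (λ j → coeff x (K ℤ.+ + suc d ℤ.- + suc j) * coeff y (m ℤ.- (K ℤ.+ + suc d) ℤ.+ + suc j)) (d ℕ.+ N)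
        ≈⟨ +-cong (trans (*-congʳ (v _ (≡.subst (K ℤ.<_) (≡.sym (ℤ.+-identityʳ _)) (i<i+1+n K d)))) (zeroˡ _))
                  (sum-cong (d ℕ.+ N) (λ j _ → reflexive (≡.cong₂ (λ a b → coeff x a * coeff y b)
                    (eq₁ K (+ d) (+ j)) (eq₂ m K (+ d) (+ j))))) ⟩
      0# + conv x y m (K ℤ.+ + d) (d ℕ.+ N)
        ≈⟨ +-identityˡ _ ⟩
      conv x y m (K ℤ.+ + d) (d ℕ.+ N)
        ≈⟨ conv-extend-top {x} {y} {m} v d N ⟩
      conv x y m K N ∎
      where
      eq₁ : ∀ K d j → K ℤ.+ (+ 1 ℤ.+ d) ℤ.- (+ 1 ℤ.+ j) ≡ K ℤ.+ d ℤ.- j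
      eq₁ = solve-∀
      eq₂ : ∀ m K d j → m ℤ.- (K ℤ.+ (+ 1 ℤ.+ d)) ℤ.+ (+ 1 ℤ.+ j) ≡ m ℤ.- (K ℤ.+ d) ℤ.+ j
      eq₂ = solve-∀

    conv-extend-bottom : ∀ {x y m K N e} → Vanish y e → e ℤ.< m ℤ.- K ℤ.+ + N →
                         ∀ d → conv x y m K (d ℕ.+ N) ≈F conv x y m K N
    conv-extend-bottom v lt zero = F.refl
    conv-extend-bottom {x} {y} {m} {K} {N} v lt (suc d) = begin
      conv x y m K (d ℕ.+ N) + coeff x (K ℤ.- + (d ℕ.+ N)) * coeff y (m ℤ.- K ℤ.+ + (d ℕ.+ N))
        ≈⟨ +-congˡ (trans (*-congˡ (v _ (ℤ.<-≤-trans lt (ℤ.+-monoʳ-≤ (m ℤ.- K) (ℤ.+≤+ (ℕ.m≤n+m N d)))))) (zeroʳ _)) ⟩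
      conv x y m K (d ℕ.+ N) + 0#
        ≈⟨ +-identityʳ _ ⟩
      conv x y m K (d ℕ.+ N)
        ≈⟨ conv-extend-bottom {x} {y} {m} v lt d ⟩
      conv x y m K N ∎

    -- The exponents K, …, K - N + 1 of x and m - K, …, m - K + N - 1 of y include all nonzero terms
    -- of coefficient m of the product.
    Window : LS → LS → ℤ → ℤ → ℕ → Set
    Window x y m K N = Vanish x K × ∃ λ e → Vanish y e × e ℤ.< m ℤ.- K ℤ.+ + N

    conv-unique-bottom : ∀ {x y m K N N′} → Window x y m K N → Window x y m K N′ →
                         conv x y m K N ≈F conv x y m K N′
    conv-unique-bottom {x} {y} {m} {K} {N} {N′} (_ , e , v , lt) (_ , e′ , v′ , lt′) with ℕ.≤-total N N′
    ... | inj₁ N≤N′ with d , refl ← difference N≤N′ = sym (conv-extend-bottom {x} {y} {m} v lt d)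
    ... | inj₂ N′≤N with d , refl ← difference N′≤N = conv-extend-bottom {x} {y} {m} v′ lt′ d

    window-extend : ∀ {x y m K N} → Window x y m K N → ∀ d → Window x y m (K ℤ.+ + d) (d ℕ.+ N)
    window-extend {x} {y} {m} {K} {N} (v , e , v′ , lt) d =
      vanish-mono x (i≤i+n K d) v , e , v′ , ≡.subst (e ℤ.<_) (eq m K (+ d) (+ N)) lt
      where
      eq : ∀ m K d N → m ℤ.- K ℤ.+ N ≡ m ℤ.- (K ℤ.+ d) ℤ.+ (d ℤ.+ N)
      eq = solve-∀

    conv-unique : ∀ {x y m K N K′ N′} → Window x y m K N → Window x y m K′ N′ →
                  conv x y m K N ≈F conv x y m K′ N′
    conv-unique {x} {y} {m} {K} {N} {K′} {N′} w w′ with ℤ.≤-total K K′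
    ... | inj₁ le with d , refl ← ≤⇒offset le =
      trans (sym (conv-extend-top {x} {y} {m} (proj₁ w) d N)) (conv-unique-bottom {x} {y} {m} (window-extend {x} {y} {m} w d) w′)
    ... | inj₂ le with d , refl ← ≤⇒offset le =
      trans (conv-unique-bottom {x} {y} {m} w (window-extend {x} {y} {m} w′ d)) (conv-extend-top {x} {y} {m} (proj₁ w′) d N′)

    -- The sum defining `*` is the window from `top x` down to the exponent paired with `top y`;
    -- `conv-unique` carries it to any other window. Above the sum of the tops the empty window is
    -- already complete.
    coeff-* : ∀ {x y m K N} → Window x y m K N → coeff (x L.* y) m ≈F conv x y m K N
    coeff-* {x@(ls k f)} {y@(ls l g)} {m} {K} {N} w with ≤-or-above m (k ℤ.+ l)
    ... | inj₂ lt = trans (vanish-top (x L.* y) m lt)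
      (conv-unique {x} {y} {m} {N = 0} (vanish-top x , l , vanish-top y , ≡.subst₂ ℤ._<_ (eq₁ k l) (eq₂ m k)
                                                 (ℤ.+-monoˡ-< (ℤ.- k) lt)) w)
      where
      eq₁ : ∀ k l → k ℤ.+ l ℤ.- k ≡ l
      eq₁ = solve-∀
      eq₂ : ∀ m k → m ℤ.- k ≡ m ℤ.- k ℤ.+ + 0
      eq₂ = solve-∀
    ... | inj₁ (n , e) = begin
      coeff (x L.* y) m
        ≡⟨ coeff-at (x L.* y) e ⟩
      sumBelow (λ j → f j * g (n ℕ.∸ j)) (suc n)
        ≈⟨ sum-cong (suc n) (λ j lt → sym (*-cong
             (reflexive (coeff-at x (eq₃ k (+ j))))
             (reflexive (coeff-at y (index j (ℕ.≤-pred lt)))))) ⟩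
      conv x y m k (suc n)
        ≈⟨ conv-unique {x} {y} {m} (vanish-top x , l , vanish-top y ,
                        ≡.subst (l ℤ.<_) (≡.sym (≡.trans (eq₅ m k (+ n)) (≡.trans
                          (≡.cong (λ z → z ℤ.- k ℤ.+ + 1) (≡.sym e)) (eq₆ k l)))) (i<i+1+n l 0)) w ⟩
      conv x y m K N ∎
      where
      eq₃ : ∀ k j → k ≡ k ℤ.- j ℤ.+ j
      eq₃ = solve-∀
      eq₅ : ∀ m k n → m ℤ.- k ℤ.+ (+ 1 ℤ.+ n) ≡ m ℤ.+ n ℤ.- k ℤ.+ + 1
      eq₅ = solve-∀
      eq₆ : ∀ k l → k ℤ.+ l ℤ.- k ℤ.+ + 1 ≡ l ℤ.+ + 1
      eq₆ = solve-∀
      index : ∀ j → j ℕ.≤ n → l ≡ m ℤ.- k ℤ.+ + j ℤ.+ + (n ℕ.∸ j)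
      index j j≤n = ≡.trans (eq₇ k l) (≡.trans (≡.cong (ℤ._- k) (≡.trans e
        (≡.cong (λ n → m ℤ.+ + n) (≡.sym (ℕ.m+[n∸m]≡n j≤n))))) (eq₈ m k (+ j) (+ (n ℕ.∸ j))))
        where
        eq₇ : ∀ k l → l ≡ k ℤ.+ l ℤ.- k
        eq₇ = solve-∀
        eq₈ : ∀ m k j i → m ℤ.+ (j ℤ.+ i) ℤ.- k ≡ m ℤ.- k ℤ.+ j ℤ.+ i
        eq₈ = solve-∀

    common-window : ∀ x x′ y y′ m → ∃ λ K → ∃ λ e → ∃ λ N →
      Vanish x K × Vanish x′ K × Vanish y e × Vanish y′ e × e ℤ.< m ℤ.- K ℤ.+ + N
    common-window x x′ y y′ m = K , e , proj₁ (exceed e (m ℤ.- K)) ,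
      vanish-mono x  (ℤ.i≤i⊔j (top x) (top x′)) (vanish-top x) ,
      vanish-mono x′ (ℤ.i≤j⊔i (top x) (top x′)) (vanish-top x′) ,
      vanish-mono y  (ℤ.i≤i⊔j (top y) (top y′)) (vanish-top y) ,
      vanish-mono y′ (ℤ.i≤j⊔i (top y) (top y′)) (vanish-top y′) ,
      proj₂ (exceed e (m ℤ.- K))
      where
      K  = top x ℤ.⊔ top x′
      e  = top y ℤ.⊔ top y′

    *L-cong : ∀ {x x′ y y′} → x L.≈ x′ → y L.≈ y′ → x L.* y L.≈ x′ L.* y′
    *L-cong {x} {x′} {y} {y′} e e′ m with K , d , N , v , v′ , w , w′ , lt ← common-window x x′ y y′ m = begin
      coeff (x L.* y) m      ≈⟨ coeff-* {x} {y} (v , d , w , lt) ⟩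
      conv x y m K N         ≈⟨ sum-cong N (λ j _ → *-cong (e _) (e′ _)) ⟩
      conv x′ y′ m K N       ≈⟨ coeff-* {x′} {y′} (v′ , d , w′ , lt) ⟨
      coeff (x′ L.* y′) m    ∎

    vanish-- : ∀ {x y r} → Vanish x r → Vanish y r → Vanish (x L.- y) r
    vanish-- {x} {y} v w i lt = trans (coeff-- x y i)
      (trans (+-cong (v i lt) (-‿cong (w i lt))) (-‿inverseʳ 0#))

    distribʳ-- : ∀ x x′ y m → coeff ((x L.- x′) L.* y) m ≈F coeff (x L.* y) m - coeff (x′ L.* y) m
    distribʳ-- x x′ y m with K , e , N , v , v′ , u , _ , lt ← common-window x x′ y y m = begin
      coeff ((x L.- x′) L.* y) m
        ≈⟨ coeff-* {x L.- x′} {y} (vanish-- {x} {x′} v v′ , e , u , lt) ⟩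
      conv (x L.- x′) y m K N
        ≈⟨ sum-cong N (λ j _ → trans (*-congʳ (coeff-- x x′ _))
             (trans (distribʳ _ _ _) (+-congˡ (sym (-‿distribˡ-* _ _))))) ⟩
      sumBelow (λ j → coeff x (K ℤ.- + j) * coeff y (m ℤ.- K ℤ.+ + j)
                      - coeff x′ (K ℤ.- + j) * coeff y (m ℤ.- K ℤ.+ + j)) N
        ≈⟨ sum-- _ _ N ⟩
      conv x y m K N - conv x′ y m K N
        ≈⟨ +-cong (coeff-* {x} {y} (v , e , u , lt)) (-‿cong (coeff-* {x′} {y} (v′ , e , u , lt))) ⟨
      coeff (x L.* y) m - coeff (x′ L.* y) m ∎

    distribˡ-- : ∀ x y y′ m → coeff (x L.* (y L.- y′)) m ≈F coeff (x L.* y) m - coeff (x L.* y′) m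
    distribˡ-- x y y′ m with K , e , N , v , _ , u , u′ , lt ← common-window x x y y′ m = begin
      coeff (x L.* (y L.- y′)) m
        ≈⟨ coeff-* {x} {y L.- y′} (v , e , vanish-- {y} {y′} u u′ , lt) ⟩
      conv x (y L.- y′) m K N
        ≈⟨ sum-cong N (λ j _ → trans (*-congˡ (coeff-- y y′ _))
             (trans (distribˡ _ _ _) (+-congˡ (sym (-‿distribʳ-* _ _))))) ⟩
      sumBelow (λ j → coeff x (K ℤ.- + j) * coeff y (m ℤ.- K ℤ.+ + j)
                      - coeff x (K ℤ.- + j) * coeff y′ (m ℤ.- K ℤ.+ + j)) N
        ≈⟨ sum-- _ _ N ⟩
      conv x y m K N - conv x y′ m K N
        ≈⟨ +-cong (coeff-* {x} {y} (v , e , u , lt)) (-‿cong (coeff-* {x} {y′} (v , e , u′ , lt))) ⟨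
      coeff (x L.* y) m - coeff (x L.* y′) m ∎

    vanish-* : ∀ {x y d e} → Vanish x d → Vanish y e → Vanish (x L.* y) (d ℤ.+ e)
    vanish-* {x} {y} {d} {e} v w i lt = coeff-* {x} {y} {i} {d} {0} (v , e , w ,
      ≡.subst₂ ℤ._<_ (eq₁ d e) (eq₂ i d) (ℤ.+-monoˡ-< (ℤ.- d) lt))
      where
      eq₁ : ∀ d e → d ℤ.+ e ℤ.- d ≡ e
      eq₁ = solve-∀
      eq₂ : ∀ i d → i ℤ.- d ≡ i ℤ.- d ℤ.+ + 0
      eq₂ = solve-∀

    -- At exponent `d + e` a window of length one starting at `d` suffices, because `y` vanishes
    -- above `e`.
    leading-* : ∀ {x y d e} → Vanish x d → Vanish y e →
                coeff (x L.* y) (d ℤ.+ e) ≈F coeff x d * coeff y e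
    leading-* {x} {y} {d} {e} v w = begin
      coeff (x L.* y) (d ℤ.+ e)
        ≈⟨ coeff-* {x} {y} {d ℤ.+ e} {d} {1} (v , e , w ,
             ≡.subst (e ℤ.<_) (eq₁ d e) (i<i+1+n e 0)) ⟩
      conv x y (d ℤ.+ e) d 1
        ≈⟨ +-identityˡ _ ⟩
      coeff x (d ℤ.- + 0) * coeff y (d ℤ.+ e ℤ.- d ℤ.+ + 0)
        ≈⟨ reflexive (≡.cong₂ (λ i j → coeff x i * coeff y j) (ℤ.+-identityʳ d) (eq₂ d e)) ⟩
      coeff x d * coeff y e ∎
      where
      eq₁ : ∀ d e → e ℤ.+ + 1 ≡ d ℤ.+ e ℤ.- d ℤ.+ + 1
      eq₁ = solve-∀
      eq₂ : ∀ d e → d ℤ.+ e ℤ.- d ℤ.+ + 0 ≡ e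
      eq₂ = solve-∀

    no-zero-divisors : ∀ {a b} → a * b ≈F 0# → ¬ (a ≈F 0#) → ¬ (b ≈F 0#) → ∀ {A : Set} → A
    no-zero-divisors {a} {b} ab≈0 a≉0 b≉0 with c , ac≈1 ← inverse a a≉0 = ⊥-elim (b≉0 (begin
      b            ≈⟨ *-identityˡ b ⟨
      1# * b       ≈⟨ *-congʳ ac≈1 ⟨
      a * c * b    ≈⟨ *-congʳ (*-comm a c) ⟩
      c * a * b    ≈⟨ *-assoc c a b ⟩
      c * (a * b)  ≈⟨ *-congˡ ab≈0 ⟩
      c * 0#       ≈⟨ zeroʳ c ⟩
      0#           ∎))

    ≈⇒-≈0 : ∀ {a b} → a ≈F b → a - b ≈F 0#
    ≈⇒-≈0 e = trans (+-congʳ e) (-‿inverseʳ _)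

    -≈0⇒≈ : ∀ {a b} → a - b ≈F 0# → a ≈F b
    -≈0⇒≈ {a} {b} e = begin
      a              ≈⟨ +-identityʳ a ⟨
      a + 0#         ≈⟨ +-congˡ (-‿inverseˡ b) ⟨
      a + (- b + b)  ≈⟨ +-assoc a (- b) b ⟨
      a - b + b      ≈⟨ +-congʳ e ⟩
      0# + b         ≈⟨ +-identityˡ b ⟩
      b              ∎

    -- Degrees, dilation of balls and cancellation.

    Degree : LS → ℤ → Set
    Degree x d = ¬ (coeff x d ≈F 0#) × Vanish x d

    distance⇒degree : ∀ {x y d} → Distance x y d → Degree (x L.- y) d
    distance⇒degree {x} {y} {d} (neq , close) =
      (λ e → neq (-≈0⇒≈ (trans (sym (coeff-- x y d)) e))) ,
      λ i lt → trans (coeff-- x y i) (≈⇒-≈0 (close i lt))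

    degree : ∀ x → ¬ (∀ i → coeff x i ≈F 0#) → ¬ ¬ (∃ (Degree x))
    degree x x≉0 k = distance x 0L (λ e → x≉0 (λ i → trans (e i) (zero-coeff i)))
      (λ (d , neq , close) → k (d , (λ e → neq (trans e (sym (zero-coeff d)))) ,
                                    λ i lt → trans (close i lt) (zero-coeff i)))
      where
      0L = ls (+ 0) (λ _ → 0#)
      zero-coeff : ∀ i → coeff 0L i ≈F 0#
      zero-coeff i with ≤-or-above i (+ 0)
      ... | inj₁ (n , e) = reflexive (coeff-at 0L {i} e)
      ... | inj₂ lt      = reflexive (coeff-above 0L {i} lt)

    scale : ∀ {a a′ b r β} → Vanish b β → a ~[ r ] a′ → (a L.* b) ~[ r ℤ.+ β ] (a′ L.* b)
    scale {a} {a′} {b} v close i lt = -≈0⇒≈ (trans (sym (distribʳ-- a a′ b i))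
      (vanish-* {a L.- a′} {b} (λ j lt′ → trans (coeff-- a a′ j) (≈⇒-≈0 (close j lt′))) v i lt))

    -- If `a - a′` had degree `d` above `r`, the coefficient of `(a - a′) b` at `d + β` would be a
    -- product of nonzero leading coefficients, while closeness makes it zero. The conclusion is
    -- decidable, so a double-negated distance is enough.
    unscale : ∀ {a a′ b r β} → Degree b β → (a L.* b) ~[ r ℤ.+ β ] (a′ L.* b) → a ~[ r ] a′
    unscale {a} {a′} {b} {r} {β} (b≉0 , v) close = decidable-stable (~-dec a r a′) (λ apart →
      distance a a′ (λ e → apart (λ i _ → e i)) (λ (d , dist) → contradict apart d dist))
      where
      contradict : ¬ a ~[ r ] a′ → ∀ d → ¬ Distance a a′ d
      contradict apart d dist@(_ , close′) with ≤-or-above d r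
      ... | inj₁ (n , e) = apart (λ i lt → close′ i (ℤ.≤-<-trans (≡.subst (d ℤ.≤_) (≡.sym e) (i≤i+n d n)) lt))
      ... | inj₂ r<d with ≉0 , w ← distance⇒degree {a} {a′} dist =
        no-zero-divisors (begin
          coeff (a L.- a′) d * coeff b β
            ≈⟨ leading-* {a L.- a′} {b} w v ⟨
          coeff ((a L.- a′) L.* b) (d ℤ.+ β)
            ≈⟨ distribʳ-- a a′ b (d ℤ.+ β) ⟩
          coeff (a L.* b) (d ℤ.+ β) - coeff (a′ L.* b) (d ℤ.+ β)
            ≈⟨ ≈⇒-≈0 (close (d ℤ.+ β) (ℤ.+-monoˡ-< β r<d)) ⟩
          0# ∎) ≉0 b≉0

    -- `unscale` at degree `i - 1` recovers the coefficient at `i`. Each such closeness is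
    -- decidable, so no double negation remains, unlike in `*-cancelˡ`.
    *-cancelʳ : ∀ {a a′ b β} → Degree b β → a L.* b L.≈ a′ L.* b → a L.≈ a′
    *-cancelʳ {a} {a′} {b} {β} deg e i =
      unscale {a} {a′} {b} {r = ℤ.pred i} deg (λ j _ → e j) i (ℤ.i≤pred[j]⇒i<j ℤ.≤-refl)

    *-cancelˡ : ∀ {x b b′ d} → Degree x d → x L.* b L.≈ x L.* b′ → ¬ ¬ (b L.≈ b′)
    *-cancelˡ {x} {b} {b′} {d} (x≉0 , v) e b≉b′ = distance b b′ b≉b′ contradict
      where
      contradict : ¬ ∃ (Distance b b′)
      contradict (f , dist) with ≉0 , w ← distance⇒degree {b} {b′} dist =
        no-zero-divisors (begin
          coeff x d * coeff (b L.- b′) f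
            ≈⟨ leading-* {x} {b L.- b′} v w ⟨
          coeff (x L.* (b L.- b′)) (d ℤ.+ f)
            ≈⟨ distribˡ-- x b b′ (d ℤ.+ f) ⟩
          coeff (x L.* b) (d ℤ.+ f) - coeff (x L.* b′) (d ℤ.+ f)
            ≈⟨ ≈⇒-≈0 (e (d ℤ.+ f)) ⟩
          0# ∎) x≉0 ≉0

    -- (a - a′) b = (a₁ - a₁′) b₁ with equal nonzero first factors.
    dilate-cancel : ∀ {a a′ a₁ a₁′ b b₁ d} → Distance a a′ d → a L.- a′ L.≈ a₁ L.- a₁′ →
      a L.* b L.≈ a₁ L.* b₁ → a′ L.* b L.≈ a₁′ L.* b₁ → ¬ ¬ (b L.≈ b₁)
    dilate-cancel {a} {a′} {a₁} {a₁′} {b} {b₁} dist e ab a′b =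
      *-cancelˡ {a L.- a′} (distance⇒degree {a} {a′} dist) (λ m → begin
        coeff ((a L.- a′) L.* b) m
          ≈⟨ distribʳ-- a a′ b m ⟩
        coeff (a L.* b) m - coeff (a′ L.* b) m
          ≈⟨ +-cong (ab m) (-‿cong (a′b m)) ⟩
        coeff (a₁ L.* b₁) m - coeff (a₁′ L.* b₁) m
          ≈⟨ distribʳ-- a₁ a₁′ b₁ m ⟨
        coeff ((a₁ L.- a₁′) L.* b₁) m
          ≈⟨ *L-cong {a L.- a′} {a₁ L.- a₁′} {b₁} {b₁} e (λ _ → F.refl) m ⟨
        coeff ((a L.- a′) L.* b₁) m ∎)

-- The bound n⁴ ≪ κ p² s.

module PairBound where

  open FiniteSums
  open BallSystems
  open import Data.Empty using (⊥-elim)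
  open import Data.Fin as Fin using (Fin; toℕ)
  open import Data.Fin.Properties using (toℕ-injective)
  open import Data.Integer as ℤ using (ℤ)
  import Data.Integer.Properties as ℤ
  open import Data.Nat using (ℕ; _+_; _*_; _≤_; _<_; z≤n; s≤s; _≤?_; >-nonZero)
  open import Data.Nat.Properties
  open import Data.Nat.Tactic.RingSolver using (solve-∀)
  open import Data.Product using (∃; _×_; _,_; proj₁; proj₂)
  open import Data.Sum using (inj₁; inj₂)
  open import Function using (_∘_; flip)
  open import Relation.Binary using (tri<; tri≈; tri>)
  open import Relation.Binary.PropositionalEquality
  open import Relation.Nullary using (¬_; Dec; yes; no)
  open import Relation.Nullary.Decidable using (_×-dec_; _→-dec_; ¬?)
  open import Relation.Unary using (Decidable)

  2xy≤x²+y² : ∀ x y → 2 * (x * y) ≤ x * x + y * y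
  2xy≤x²+y² x y with ≤-total x y
  ... | inj₁ x≤y with k , refl ← m≤n⇒∃[o]m+o≡n x≤y =
    ≤-trans (m≤m+n _ (k * k)) (≤-reflexive (lemma x k))
    where
    lemma : ∀ x k → 2 * (x * (x + k)) + k * k ≡ x * x + (x + k) * (x + k)
    lemma = solve-∀
  ... | inj₂ y≤x with k , refl ← m≤n⇒∃[o]m+o≡n y≤x =
    ≤-trans (m≤m+n _ (k * k)) (≤-reflexive (lemma y k))
    where
    lemma : ∀ y k → 2 * ((y + k) * y) + k * k ≡ (y + k) * (y + k) + y * y
    lemma = solve-∀

  -- Both sides are doubled and expanded into double sums, which compare termwise by `2xy≤x²+y²`;
  -- this avoids subtraction in the naturals. The weight `w` serves as the indicator of a set of
  -- class representatives.
  cauchy-schwarz : ∀ {X} {{_ : Finite X}} (w f : X → ℕ) →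
    ∑ (λ x → w x * f x) * ∑ (λ x → w x * f x) ≤ ∑ w * ∑ (λ x → w x * (f x * f x))
  cauchy-schwarz w f = *-cancelˡ-≤ 2 (begin
    2 * (∑ wf * ∑ wf)
      ≡⟨ cong (2 *_) (∑*∑ wf wf) ⟩
    2 * ∑ (λ x → ∑ (λ y → wf x * wf y))
      ≡⟨ trans (∑-cong (λ x → ∑-*ˡ 2 (λ y → wf x * wf y))) (∑-*ˡ 2 (λ x → ∑ (λ y → wf x * wf y))) ⟨
    ∑ (λ x → ∑ (λ y → 2 * (wf x * wf y)))
      ≤⟨ ∑-mono (λ x → ∑-mono (λ y → pointwise (w x) (w y) (f x) (f y))) ⟩
    ∑ (λ x → ∑ (λ y → wff x * w y + w x * wff y))
      ≡⟨ trans (∑-cong (λ x → ∑-+ (λ y → wff x * w y) (λ y → w x * wff y)))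
               (∑-+ (λ x → ∑ (λ y → wff x * w y)) (λ x → ∑ (λ y → w x * wff y))) ⟩
    ∑ (λ x → ∑ (λ y → wff x * w y)) + ∑ (λ x → ∑ (λ y → w x * wff y))
      ≡⟨ cong₂ _+_ (∑*∑ wff w) (∑*∑ w wff) ⟨
    ∑ wff * ∑ w + ∑ w * ∑ wff
      ≡⟨ lemma (∑ w) (∑ wff) ⟩
    2 * (∑ w * ∑ wff) ∎)
    where
    open ≤-Reasoning
    wf  = λ x → w x * f x
    wff = λ x → w x * (f x * f x)
    lemma : ∀ a b → b * a + a * b ≡ 2 * (a * b)
    lemma = solve-∀
    pointwise : ∀ u v x y → 2 * (u * x * (v * y)) ≤ u * (x * x) * v + u * (v * (y * y))
    pointwise u v x y = begin
      2 * (u * x * (v * y))               ≡⟨ left u v x y ⟩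
      u * v * (2 * (x * y))               ≤⟨ *-monoʳ-≤ (u * v) (2xy≤x²+y² x y) ⟩
      u * v * (x * x + y * y)             ≡⟨ right u v x y ⟩
      u * (x * x) * v + u * (v * (y * y)) ∎
      where
      left : ∀ u v x y → 2 * (u * x * (v * y)) ≡ u * v * (2 * (x * y))
      left = solve-∀
      right : ∀ u v x y → u * v * (x * x + y * y) ≡ u * (x * x) * v + u * (v * (y * y))
      right = solve-∀

  -- The number of related pairs in S is the sum of the squares of the class sizes, and R counts the classes.
  related-pairs : ∀ {X} {{_ : Finite X}} {_~_ : X → X → Set} {S R : X → Set}
    (~? : ∀ x y → Dec (x ~ y)) (S? : Decidable S) (R? : Decidable R) →
    (∀ {x y z} → x ~ z → y ~ z → y ~ x) → (∀ {x y z} → x ~ y → x ~ z → y ~ z) →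
    (∀ {x} → S x → ∃ λ c → R c × x ~ c) →
    (∀ {c c′} → R c → R c′ → c ~ c′ → c ≡ c′) →
    count S? * count S? ≤ count R? * ∑ (λ x → 𝟙 (S? x) * count (λ y → S? y ×-dec ~? y x))
  related-pairs ~? S? R? join fork rep rep-unique = begin
    count S? * count S?
      ≤⟨ *-mono-≤ cover cover ⟩
    ∑ (λ c → 𝟙 (R? c) * m c) * ∑ (λ c → 𝟙 (R? c) * m c)
      ≤⟨ cauchy-schwarz (λ c → 𝟙 (R? c)) m ⟩
    count R? * ∑ (λ c → 𝟙 (R? c) * (m c * m c))
      ≤⟨ *-monoʳ-≤ (count R?) squares ⟩
    count R? * ∑ (λ x → 𝟙 (S? x) * count (λ y → S? y ×-dec ~? y x)) ∎
    where
    open ≤-Reasoning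
    in? = λ c x → S? x ×-dec ~? x c
    m   = λ c → count (in? c)
    cover : count S? ≤ ∑ (λ c → 𝟙 (R? c) * m c)
    cover = begin
      count S?
        ≤⟨ ∑-mono (λ x → 𝟙-≤ (S? x) (λ sx → let (c , rc , xc) = rep sx in
             ≤-trans (*-mono-≤ (𝟙-≥ (R? c) rc) (𝟙-≥ (in? c x) (sx , xc)))
                     (∑-term (λ c → 𝟙 (R? c) * 𝟙 (in? c x)) c))) ⟩
      ∑ (λ x → ∑ (λ c → 𝟙 (R? c) * 𝟙 (in? c x)))
        ≡⟨ ∑-swap (λ x c → 𝟙 (R? c) * 𝟙 (in? c x)) ⟩
      ∑ (λ c → ∑ (λ x → 𝟙 (R? c) * 𝟙 (in? c x)))
        ≡⟨ ∑-cong (λ c → ∑-*ˡ (𝟙 (R? c)) (λ x → 𝟙 (in? c x))) ⟩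
      ∑ (λ c → 𝟙 (R? c) * m c) ∎
    triple? = λ c x y → R? c ×-dec (in? c x ×-dec in? c y)
    expand : ∀ c → 𝟙 (R? c) * (m c * m c) ≡ ∑ (λ x → ∑ (λ y → 𝟙 (triple? c x y)))
    expand c = begin-equality
      𝟙 (R? c) * (m c * m c)
        ≡⟨ cong (𝟙 (R? c) *_) (∑*∑ (λ x → 𝟙 (in? c x)) (λ y → 𝟙 (in? c y))) ⟩
      𝟙 (R? c) * ∑ (λ x → ∑ (λ y → 𝟙 (in? c x) * 𝟙 (in? c y)))
        ≡⟨ trans (∑-cong (λ x → ∑-*ˡ (𝟙 (R? c)) (λ y → 𝟙 (in? c x) * 𝟙 (in? c y))))
                 (∑-*ˡ (𝟙 (R? c)) (λ x → ∑ (λ y → 𝟙 (in? c x) * 𝟙 (in? c y)))) ⟨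
      ∑ (λ x → ∑ (λ y → 𝟙 (R? c) * (𝟙 (in? c x) * 𝟙 (in? c y))))
        ≡⟨ ∑-cong (λ x → ∑-cong (λ y →
             trans (𝟙-× (R? c) (in? c x ×-dec in? c y)) (cong (𝟙 (R? c) *_) (𝟙-× (in? c x) (in? c y))))) ⟨
      ∑ (λ x → ∑ (λ y → 𝟙 (triple? c x y))) ∎
    squares : ∑ (λ c → 𝟙 (R? c) * (m c * m c)) ≤ ∑ (λ x → 𝟙 (S? x) * count (λ y → in? x y))
    squares = begin
      ∑ (λ c → 𝟙 (R? c) * (m c * m c))
        ≡⟨ ∑-cong expand ⟩
      ∑ (λ c → ∑ (λ x → ∑ (λ y → 𝟙 (triple? c x y))))
        ≡⟨ trans (∑-swap (λ c x → ∑ (λ y → 𝟙 (triple? c x y))))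
                 (∑-cong (λ x → ∑-swap (λ c y → 𝟙 (triple? c x y)))) ⟩
      ∑ (λ x → ∑ (λ y → ∑ (λ c → 𝟙 (triple? c x y))))
        -- For given `x` and `y` at most one representative `c` is related to both, so the sum over
        -- `c` is at most an indicator.
        ≤⟨ ∑-mono (λ x → ∑-mono (λ y → ∑-single _ (𝟙 (S? x ×-dec in? x y))
             (λ c → 𝟙-mono (triple? c x y) (S? x ×-dec in? x y)
                (λ (_ , (sx , xc) , (sy , yc)) → sx , sy , join xc yc))
             (λ c c′ h h′ →
                let (rc , (_ , xc) , _)   = 𝟙≢0 (triple? c x y) h
                    (rc′ , (_ , xc′) , _) = 𝟙≢0 (triple? c′ x y) h′
                in rep-unique rc rc′ (fork xc xc′)))) ⟩
      ∑ (λ x → ∑ (λ y → 𝟙 (S? x ×-dec in? x y)))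
        ≡⟨ ∑-cong (λ x → trans (∑-cong (λ y → 𝟙-× (S? x) (in? x y)))
                               (∑-*ˡ (𝟙 (S? x)) (λ y → 𝟙 (in? x y)))) ⟩
      ∑ (λ x → 𝟙 (S? x) * count (λ y → in? x y)) ∎

  -- mul a b and sd c a a′ are the indices of a b in AA and of c + a - a′ in A + A - A.
  module _ {n p s : ℕ} (ballsA : BallSystem (Fin n)) (ballsP : BallSystem (Fin p)) where

    open BallSystem ballsA
    open BallSystem ballsP using () renaming
      (_~[_]_ to _≈[_]_; ~-dec to ≈-dec; ~-refl to ≈-refl; ~-sym to ≈-sym; ~-trans to ≈-trans; ~-mono to ≈-mono)

    -- `ρ a` stands for the distance from `a` to its nearest neighbour `near a`, and `β b` for the
    -- degree of a nonzero `b`, so that dilation by `b` turns degree `r` into `r + β b`. `sd-close`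
    -- recovers `c` from `c + a - a′` up to the larger radius, and `sd-inj` recovers the rest once
    -- `c` is known.
    module _
      (2≤n : 2 ≤ n)
      (mul : Fin n → Fin n → Fin p) (sd : Fin n → Fin n → Fin n → Fin s)
      (ρ β : Fin n → ℤ) {NZ : Fin n → Set} (NZ? : Decidable NZ)
      (zero-unique : ∀ {b b′} → ¬ NZ b → ¬ NZ b′ → b ≡ b′)
      (near : Fin n → Fin n) (near≢ : ∀ a → near a ≢ a) (near~ : ∀ a → near a ~[ ρ a ] a)
      (isolated : ∀ {a a′ r} → r ℤ.< ρ a → a′ ~[ r ] a → a′ ≡ a)
      (scale : ∀ {a a′ b r} → NZ b → a ~[ r ] a′ → mul a b ≈[ r ℤ.+ β b ] mul a′ b)
      (sd-close : ∀ {a a′ a₁ a₁′ c c₁} → a′ ~[ ρ a ] a → a₁′ ~[ ρ a₁ ] a₁ →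
                  sd c a a′ ≡ sd c₁ a₁ a₁′ → c ~[ ρ a ℤ.⊔ ρ a₁ ] c₁)
      (sd-inj : ∀ {a a′ a₁ a₁′ b b₁ c} → a′ ≢ a → NZ b → NZ b₁ → sd c a a′ ≡ sd c a₁ a₁′ →
                mul a b ≡ mul a₁ b₁ → mul a′ b ≡ mul a₁′ b₁ → b ≡ b₁ × a ≡ a₁ × a′ ≡ a₁′)
      (κ : ℕ)
      (κ-bound : ∀ {b} → NZ b → ∀ x → count (λ a → ≈-dec (mul a b) (ρ a ℤ.+ β b) x) ≤ κ)
      where

      private
        open ≤-Reasoning

        t : Fin n → Fin n → ℤ
        t a b = ρ a ℤ.+ β b

        ball : Fin n → Fin n → ℕ
        ball a b = count (≈-dec (mul a b) (t a b))

        -- The threshold is eight times the bound `κ p / n` on the mean ball size. At most `n/8`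
        -- elements then fail, few enough to be removed from `n²/4` pairs or from `n/2` elements.
        Good : Fin n → Fin n → Set
        Good a b = NZ b × n * ball a b ≤ 8 * (κ * p)

        good? : ∀ a b → Dec (Good a b)
        good? a b = NZ? b ×-dec (n * ball a b ≤? 8 * (κ * p))

        bad : Fin n → ℕ
        bad b = count (λ a → ¬? (good? a b))

        a₀ : Fin n
        a₀ = Fin.fromℕ< {0} (≤-trans (s≤s z≤n) 2≤n)

        some-x : 1 ≤ p
        some-x = Fin⇒1≤ (mul a₀ a₀)

        -- Markov's inequality, multiplied out by `κ p`. Read point by point, the balls for a fixed
        -- `b` cover each `x` at most `κ` times, so their sizes add up to at most `κ p`.
        bad-few : ∀ {b} → NZ b → 8 * bad b ≤ n
        bad-few {b} nz = *-cancelˡ-≤ (κ * p) {{>-nonZero (*-mono-≤ 1≤κ some-x)}} (begin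
          κ * p * (8 * bad b)
            ≡⟨ lemma (κ * p) (bad b) ⟩
          bad b * (8 * (κ * p))
            ≡⟨ ∑-*ʳ (8 * (κ * p)) (λ a → 𝟙 (¬? (good? a b))) ⟨
          ∑ (λ a → 𝟙 (¬? (good? a b)) * (8 * (κ * p)))
            ≤⟨ ∑-mono (λ a → 𝟙*-≤ (¬? (good? a b)) exceeds) ⟩
          ∑ (λ a → n * ball a b)
            ≡⟨ ∑-*ˡ n (λ a → ball a b) ⟩
          n * ∑ (λ a → ball a b)
            ≡⟨ cong (n *_) (∑-swap (λ a x → 𝟙 (≈-dec (mul a b) (t a b) x))) ⟩
          n * ∑ (λ x → count (λ a → ≈-dec (mul a b) (t a b) x))
            ≤⟨ *-monoʳ-≤ n (∑-bound κ (κ-bound nz)) ⟩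
          n * (card (Fin p) * κ)
            ≡⟨ cong (λ m → n * (m * κ)) (card-Fin p) ⟩
          n * (p * κ)
            ≡⟨ lemma₂ n p κ ⟩
          κ * p * n ∎)
          where
          lemma : ∀ a b → a * (8 * b) ≡ b * (8 * a)
          lemma = solve-∀
          lemma₂ : ∀ n p κ → n * (p * κ) ≡ κ * p * n
          lemma₂ = solve-∀
          1≤κ : 1 ≤ κ
          1≤κ = ≤-trans (count>0 (λ a → ≈-dec (mul a b) (t a b) (mul a₀ b)) ≈-refl) (κ-bound nz (mul a₀ b))
          exceeds : ∀ {a} → ¬ Good a b → 8 * (κ * p) ≤ n * ball a b
          exceeds ¬g = ≮⇒≥ (λ h → ¬g (nz , <⇒≤ h))

        Covers : Fin p → Fin p → Fin n × Fin n → Set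
        Covers x x′ (a , b) = Good a b × mul a b ≈[ t a b ] x × mul a b ≈[ t a b ] x′

        covers? : ∀ x x′ → Decidable (Covers x x′)
        covers? x x′ (a , b) = good? a b ×-dec (≈-dec (mul a b) (t a b) x ×-dec ≈-dec (mul a b) (t a b) x′)

        -- The good balls of all `b` are taken together: counting pairs separately for each `b`
        -- could lose a factor `n`.
        Pair : Fin p × Fin p → Set
        Pair (x , x′) = ∃ (Covers x x′)

        pair? : Decidable Pair
        pair? (x , x′) = any? (covers? x x′)

        -- All good balls containing x lie in the largest one.
        partners-few : ∀ x → n * count (λ x′ → pair? (x , x′)) ≤ 8 * (κ * p)
        partners-few x with any? (covers? x x)
        ... | no none = begin
          n * count (λ x′ → pair? (x , x′))
            ≤⟨ *-monoʳ-≤ n (∑-mono {g = λ _ → 0} (λ x′ → 𝟙-≤ (pair? (x , x′))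
                 (λ (ab , g , h , _) → ⊥-elim (none (ab , g , h , h))))) ⟩
          n * ∑ {Fin p} (λ _ → 0)  ≡⟨ cong (n *_) (trans (∑-const {Fin p} 0) (*-zeroʳ (card (Fin p)))) ⟩
          n * 0                    ≡⟨ *-zeroʳ n ⟩
          0                        ≤⟨ z≤n ⟩
          8 * (κ * p)              ∎
        ... | yes some
          with (a , b) , (g , h , _) , largest ←
               least (covers? x x) (λ (a , b) (a₁ , b₁) → t a₁ b₁ ℤ.≤ t a b)
                     (λ (a , b) (a₁ , b₁) → ℤ.≤-total (t a₁ b₁) (t a b)) (flip ℤ.≤-trans) some = begin
          n * count (λ x′ → pair? (x , x′))
            ≤⟨ *-monoʳ-≤ n (count-mono (λ x′ → pair? (x , x′)) (≈-dec (mul a b) (t a b))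
                 (λ (ab₁ , g₁ , h₁ , h₁′) →
                    ≈-trans h (≈-mono (largest ab₁ (g₁ , h₁ , h₁)) (≈-trans (≈-sym h₁) h₁′)))) ⟩
          n * ball a b ≤⟨ proj₂ g ⟩
          8 * (κ * p)  ∎

        pairs-few : n * count pair? ≤ p * (8 * (κ * p))
        pairs-few = begin
          n * count pair?
            ≡⟨ cong (n *_) (∑-× (λ xx′ → 𝟙 (pair? xx′))) ⟩
          n * ∑ (λ x → count (λ x′ → pair? (x , x′)))
            ≡⟨ ∑-*ˡ n (λ x → count (λ x′ → pair? (x , x′))) ⟨
          ∑ (λ x → n * count (λ x′ → pair? (x , x′)))
            ≤⟨ ∑-bound (8 * (κ * p)) partners-few ⟩
          card (Fin p) * (8 * (κ * p))
            ≡⟨ cong (_* (8 * (κ * p))) (card-Fin p) ⟩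
          p * (8 * (κ * p)) ∎

        near-set : (a : Fin n) → Decidable (λ a′ → a′ ≢ a × a′ ~[ ρ a ] a)
        near-set a a′ = ¬? (dec≡ a′ a) ×-dec ~-dec a′ (ρ a) a

        v : Fin n → ℕ
        v a = count (near-set a)

        1≤v : ∀ a → 1 ≤ v a
        1≤v a = count>0 (near-set a) (near≢ a , near~ a)

        -- `G` decides which `c` may accompany `a`; the two cases of the proof differ only in this
        -- choice. Equal values of `c + a - a′` bring two such `c` within the larger radius, and
        -- `separated` turns this into equality.
        module _ {G : Fin n → Fin n → Set} (G? : ∀ a c → Dec (G a c))
                 (separated : ∀ {a a₁ c c₁} → G a c → G a₁ c₁ → c ~[ ρ a ℤ.⊔ ρ a₁ ] c₁ → c ≡ c₁) where

          Tuple : Set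
          Tuple = Fin n × Fin n × Fin n × Fin n

          T : Tuple → Set
          T (b , a , a′ , c) = (Good a b × G a c) × a′ ≢ a × a′ ~[ ρ a ] a

          T? : Decidable T
          T? (b , a , a′ , c) = (good? a b ×-dec G? a c) ×-dec near-set a a′

          T-few : n * count T? ≤ p * (8 * (κ * p)) * s
          T-few = begin
            n * count T?
              ≤⟨ *-monoʳ-≤ n (count-inj T? (λ ((x , z) : (Fin p × Fin p) × Fin s) → pair? x)
                   (λ (b , a , a′ , c) → (mul a b , mul a′ b) , sd c a a′) target injective) ⟩
            n * count (λ ((x , z) : (Fin p × Fin p) × Fin s) → pair? x)
              ≡⟨ cong (n *_) (∑-× (λ ((x , z) : (Fin p × Fin p) × Fin s) → 𝟙 (pair? x))) ⟩
            n * ∑ (λ x → ∑ {Fin s} (λ _ → 𝟙 (pair? x)))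
              ≡⟨ cong (n *_) (∑-cong (λ x → trans (∑-const {Fin s} (𝟙 (pair? x)))
                   (trans (cong (_* 𝟙 (pair? x)) (card-Fin s)) (*-comm s _)))) ⟩
            n * ∑ (λ x → 𝟙 (pair? x) * s)
              ≡⟨ cong (n *_) (∑-*ʳ s (λ x → 𝟙 (pair? x))) ⟩
            n * (count pair? * s)
              ≡⟨ *-assoc n (count pair?) s ⟨
            n * count pair? * s
              ≤⟨ *-monoˡ-≤ s pairs-few ⟩
            p * (8 * (κ * p)) * s ∎
            where
            target : ∀ {τ@(b , a , a′ , c) : Tuple} → T τ → Pair (mul a b , mul a′ b)
            target {b , a , a′ , c} ((g , _) , _ , h) =
              (a , b) , g , ≈-refl , scale (proj₁ g) (~-sym h)
            injective : ∀ {τ@(b , a , a′ , c) τ₁@(b₁ , a₁ , a₁′ , c₁) : Tuple} → T τ → T τ₁ →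
              ((mul a b , mul a′ b) , sd c a a′) ≡ ((mul a₁ b₁ , mul a₁′ b₁) , sd c₁ a₁ a₁′) → τ ≡ τ₁
            injective ((g , h) , a′≢a , q) ((g₁ , h₁) , _ , q₁) e
              -- Equal sums put `c` and `c₁` in one ball, so they coincide. Then `a - a′` is known,
              -- `(a - a′) b` gives `b`, and the two products give `a` and `a′`.
              with refl ← separated h h₁ (sd-close q q₁ (cong proj₂ e))
              with refl , refl , refl ← sd-inj a′≢a (proj₁ g) (proj₁ g₁) (cong proj₂ e)
                     (cong (proj₁ ∘ proj₁) e) (cong (proj₂ ∘ proj₁) e) = refl

          row : Fin n → ℕ
          row b = ∑ (λ a → 𝟙 (good? a b) * (v a * count (G? a)))

          T-rows : count T? ≡ ∑ row
          T-rows = trans (∑-× (λ τ → 𝟙 (T? τ))) (∑-cong (λ b →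
                   trans (∑-× (λ τ → 𝟙 (T? (b , τ)))) (∑-cong (λ a →
                   trans (∑-× (λ τ → 𝟙 (T? (b , a , τ)))) (inner b a)))))
            where
            lemma : ∀ g h q → g * h * q ≡ g * (q * h)
            lemma = solve-∀
            inner : ∀ b a → ∑ (λ a′ → ∑ (λ c → 𝟙 (T? (b , a , a′ , c))))
                            ≡ 𝟙 (good? a b) * (v a * count (G? a))
            inner b a = begin-equality
              ∑ (λ a′ → ∑ (λ c → 𝟙 (T? (b , a , a′ , c))))
                ≡⟨ ∑-cong (λ a′ → ∑-cong (λ c →
                     trans (𝟙-× (good? a b ×-dec G? a c) (near-set a a′))
                    (trans (cong (_* 𝟙 (near-set a a′)) (𝟙-× (good? a b) (G? a c)))
                           (lemma (𝟙 (good? a b)) _ _)))) ⟩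
              ∑ (λ a′ → ∑ (λ c → 𝟙 (good? a b) * (𝟙 (near-set a a′) * 𝟙 (G? a c))))
                ≡⟨ ∑-cong (λ a′ → ∑-*ˡ (𝟙 (good? a b)) (λ c → 𝟙 (near-set a a′) * 𝟙 (G? a c))) ⟩
              ∑ (λ a′ → 𝟙 (good? a b) * ∑ (λ c → 𝟙 (near-set a a′) * 𝟙 (G? a c)))
                ≡⟨ ∑-*ˡ (𝟙 (good? a b)) (λ a′ → ∑ (λ c → 𝟙 (near-set a a′) * 𝟙 (G? a c))) ⟩
              𝟙 (good? a b) * ∑ (λ a′ → ∑ (λ c → 𝟙 (near-set a a′) * 𝟙 (G? a c)))
                ≡⟨ cong (𝟙 (good? a b) *_) (∑*∑ (λ a′ → 𝟙 (near-set a a′)) (λ c → 𝟙 (G? a c))) ⟨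
              𝟙 (good? a b) * (v a * count (G? a)) ∎

          nonzero-many : n ≤ 2 * count NZ?
          nonzero-many = ≤-trans n≤c+1 (enough (count NZ?) (+-cancelʳ-≤ 1 1 _ (≤-trans 2≤n n≤c+1)))
            where
            enough : ∀ c → 1 ≤ c → c + 1 ≤ 2 * c
            enough c h = +-monoʳ-≤ c (≤-trans h (≤-reflexive (sym (+-identityʳ c))))
            n≤c+1 : n ≤ count NZ? + 1
            n≤c+1 = begin
              n                                            ≡⟨ card-Fin n ⟨
              card (Fin n)                                 ≡⟨ *-identityʳ _ ⟨
              card (Fin n) * 1                             ≡⟨ ∑-const {Fin n} 1 ⟨
              ∑ {Fin n} (λ _ → 1)                          ≤⟨ ∑-mono split ⟩
              ∑ (λ b → 𝟙 (NZ? b) + 𝟙 (¬? (NZ? b)))         ≡⟨ ∑-+ (λ b → 𝟙 (NZ? b)) (λ b → 𝟙 (¬? (NZ? b))) ⟩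
              count NZ? + count (λ b → ¬? (NZ? b))         ≤⟨ +-monoʳ-≤ _ (count-single (λ b → ¬? (NZ? b)) zero-unique) ⟩
              count NZ? + 1                                ∎
              where
              split : ∀ b → 1 ≤ 𝟙 (NZ? b) + 𝟙 (¬? (NZ? b))
              split b with NZ? b
              ... | yes _ = s≤s z≤n
              ... | no _  = s≤s z≤n

          -- The constant is 2 · 16 · 8: at least half of the `b` are nonzero, each of them has at
          -- least `n²/16` tuples, and 8 is the threshold for good balls.
          conclude : (∀ {b} → NZ b → n * n ≤ 16 * row b) → n * (n * n * n) ≤ 256 * (κ * (p * p) * s)
          conclude h = begin
            n * (n * n * n)                  ≡⟨ cong (n *_) (*-assoc n n n) ⟩
            n * (n * (n * n))                ≤⟨ *-monoʳ-≤ n (*-monoˡ-≤ (n * n) nonzero-many) ⟩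
            n * (2 * count NZ? * (n * n))    ≤⟨ *-monoʳ-≤ n T-many ⟩
            n * (32 * count T?)              ≡⟨ lemma n (count T?) ⟩
            32 * (n * count T?)              ≤⟨ *-monoʳ-≤ 32 T-few ⟩
            32 * (p * (8 * (κ * p)) * s)     ≡⟨ lemma₂ p κ s ⟩
            256 * (κ * (p * p) * s)          ∎
            where
            lemma : ∀ n c → n * (32 * c) ≡ 32 * (n * c)
            lemma = solve-∀
            lemma₂ : ∀ p κ s → 32 * (p * (8 * (κ * p)) * s) ≡ 256 * (κ * (p * p) * s)
            lemma₂ = solve-∀
            T-many : 2 * count NZ? * (n * n) ≤ 32 * count T?
            T-many = begin
              2 * count NZ? * (n * n)               ≡⟨ *-assoc 2 (count NZ?) (n * n) ⟩
              2 * (count NZ? * (n * n))             ≡⟨ cong (2 *_) (∑-*ʳ (n * n) (λ b → 𝟙 (NZ? b))) ⟨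
              2 * ∑ (λ b → 𝟙 (NZ? b) * (n * n))     ≤⟨ *-monoʳ-≤ 2 (∑-mono (λ b → 𝟙*-≤ (NZ? b) h)) ⟩
              2 * ∑ (λ b → 16 * row b)              ≡⟨ cong (2 *_) (∑-*ˡ 16 row) ⟩
              2 * (16 * ∑ row)                      ≡⟨ *-assoc 2 16 (∑ row) ⟨
              32 * ∑ row                            ≡⟨ cong (32 *_) T-rows ⟨
              32 * count T?                         ∎

        Conclusion : Set
        Conclusion = n * (n * n * n) ≤ 256 * (κ * (p * p) * s)

        -- First case: many pairs with distinct radii.

        larger? : ∀ a c → Dec (ρ a ℤ.< ρ c)
        larger? a c = ρ a ℤ.<? ρ c

        strict-pairs : ℕ
        strict-pairs = ∑ (λ a → count (larger? a))

        -- The larger of `ρ a` and `ρ a₁` is strictly below the `ρ` of the `c` that accompanies it,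
        -- and a ball of degree below that around this `c` contains no other element.
        strict-case : n * n ≤ 4 * strict-pairs → Conclusion
        strict-case h = conclude larger? separated row-large
          where
          separated : ∀ {a a₁ c c₁} → ρ a ℤ.< ρ c → ρ a₁ ℤ.< ρ c₁ → c ~[ ρ a ℤ.⊔ ρ a₁ ] c₁ → c ≡ c₁
          separated {a} {a₁} {c} {c₁} a<c a₁<c₁ q with ℤ.≤-total (ρ a) (ρ a₁)
          ... | inj₁ le = isolated a₁<c₁ (subst (c ~[_] c₁) (ℤ.i≤j⇒i⊔j≡j le) q)
          ... | inj₂ le = sym (isolated a<c (~-sym (subst (c ~[_] c₁) (ℤ.i≥j⇒i⊔j≡i le) q)))
          row-large : ∀ {b} → NZ b → n * n ≤ 16 * row larger? separated b
          row-large {b} nz = +-cancelʳ-≤ (n * n) _ _ (begin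
            n * n + n * n                     ≤⟨ +-mono-≤ h h ⟩
            4 * strict-pairs + 4 * strict-pairs
                                              ≡⟨ *-distribʳ-+ strict-pairs 4 4 ⟨
            8 * strict-pairs                  ≤⟨ *-monoʳ-≤ 8 pairs-split ⟩
            8 * (r + bad b * n)               ≡⟨ lemma r (bad b) n ⟩
            -- The bad `a` account for at most `n²/8` pairs. The factor 8 is relaxed to 16, the
            -- constant of the other case.
            8 * r + 8 * bad b * n             ≤⟨ +-mono-≤ (*-monoˡ-≤ r (m≤n+m 8 8)) (*-monoˡ-≤ n (bad-few nz)) ⟩
            16 * r + n * n                    ∎)
            where
            r = row larger? separated b
            lemma : ∀ r b n → 8 * (r + b * n) ≡ 8 * r + 8 * b * n
            lemma = solve-∀
            pairs-split : strict-pairs ≤ r + bad b * n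
            pairs-split = begin
              ∑ (λ a → count (larger? a))
                ≤⟨ ∑-mono (λ a → ≤-𝟙-split (good? a b)
                     (λ _ → ≤-trans (≤-reflexive (sym (*-identityˡ _))) (*-monoˡ-≤ (count (larger? a)) (1≤v a)))
                     (λ _ → ≤-trans (count≤card (larger? a)) (≤-reflexive (card-Fin n)))) ⟩
              ∑ (λ a → 𝟙 (good? a b) * (v a * count (larger? a)) + 𝟙 (¬? (good? a b)) * n)
                ≡⟨ ∑-+ (λ a → 𝟙 (good? a b) * (v a * count (larger? a))) (λ a → 𝟙 (¬? (good? a b)) * n) ⟩
              r + ∑ (λ a → 𝟙 (¬? (good? a b)) * n)
                ≡⟨ cong (r +_) (∑-*ʳ n (λ a → 𝟙 (¬? (good? a b)))) ⟩
              r + bad b * n ∎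

        -- Second case: one radius shared by half of the elements.

        module Tie (r : ℤ) (many : n ≤ 2 * count (λ a → ρ a ℤ.≟ r)) where

          D : Fin n → Set
          D a = ρ a ≡ r

          D? : Decidable D
          D? a = ρ a ℤ.≟ r

          -- The least index is a decidable choice of exactly one element in each ball of degree `r`
          -- that meets `D`.
          Rep : Fin n → Set
          Rep c = D c × (∀ c′ → D c′ × c′ ~[ r ] c → toℕ c ≤ toℕ c′)

          rep? : Decidable Rep
          rep? c = D? c ×-dec all? (λ c′ → (D? c′ ×-dec ~-dec c′ r c) →-dec (toℕ c ≤? toℕ c′))

          rep-unique : ∀ {c c′} → Rep c → Rep c′ → c ~[ r ] c′ → c ≡ c′
          rep-unique (d , l) (d′ , l′) q =
            toℕ-injective (≤-antisym (l _ (d′ , ~-sym q)) (l′ _ (d , q)))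

          rep : ∀ {a} → D a → ∃ λ c → Rep c × a ~[ r ] c
          rep {a} da with c , (dc , q) , l ←
            least (λ c → D? c ×-dec ~-dec a r c) (λ c c′ → toℕ c ≤ toℕ c′)
                  (λ c c′ → ≤-total (toℕ c) (toℕ c′)) ≤-trans (a , da , ~-refl)
            = c , (dc , λ c′ (dc′ , q′) → l c′ (dc′ , ~-trans q (~-sym q′))) , q

          G? : ∀ a c → Dec (D a × Rep c)
          G? a c = D? a ×-dec rep? c

          separated : ∀ {a a₁ c c₁} → D a × Rep c → D a₁ × Rep c₁ → c ~[ ρ a ℤ.⊔ ρ a₁ ] c₁ → c ≡ c₁
          separated {c = c} {c₁} (refl , h) (e , h₁) q =
            rep-unique h h₁ (subst (c ~[_] c₁) (trans (cong (r ℤ.⊔_) e) (ℤ.⊔-idem r)) q)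

          module _ {b} (nz : NZ b) where

            S? : Decidable (λ a → D a × Good a b)
            S? a = D? a ×-dec good? a b

            -- `E` counts pairs of good elements in a common ball, and `R` counts the balls of
            -- degree `r` meeting `D`. The number of tuples for `b` is `R * Σv`: if the balls are
            -- few, they are crowded and offer many `a′`, and Cauchy-Schwarz makes this trade exact.
            M R E Σv : ℕ
            M  = count S?
            R  = count rep?
            E  = ∑ (λ a → 𝟙 (S? a) * count (λ a′ → S? a′ ×-dec ~-dec a′ r a))
            Σv = ∑ (λ a → 𝟙 (S? a) * v a)

            M-large : 3 * n ≤ 8 * M
            M-large = +-cancelʳ-≤ n _ _ (begin
              3 * n + n              ≡⟨ lemma n ⟩
              4 * n                  ≤⟨ *-monoʳ-≤ 4 many ⟩
              4 * (2 * count D?)     ≡⟨ *-assoc 4 2 (count D?) ⟨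
              8 * count D?           ≤⟨ *-monoʳ-≤ 8 split ⟩
              8 * (M + bad b)        ≡⟨ *-distribˡ-+ 8 M (bad b) ⟩
              8 * M + 8 * bad b      ≤⟨ +-monoʳ-≤ (8 * M) (bad-few nz) ⟩
              8 * M + n              ∎)
              where
              lemma : ∀ n → 3 * n + n ≡ 4 * n
              lemma = solve-∀
              split : count D? ≤ M + bad b
              split = begin
                ∑ (λ a → 𝟙 (D? a))
                  ≤⟨ ∑-mono (λ a → 𝟙-≤ (D? a) (λ d → pointwise a d)) ⟩
                ∑ (λ a → 𝟙 (S? a) + 𝟙 (¬? (good? a b)))
                  ≡⟨ ∑-+ (λ a → 𝟙 (S? a)) (λ a → 𝟙 (¬? (good? a b))) ⟩
                M + bad b ∎
                where
                pointwise : ∀ a → D a → 1 ≤ 𝟙 (S? a) + 𝟙 (¬? (good? a b))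
                pointwise a d with good? a b in eq
                ... | yes g = ≤-trans (𝟙-≥ (D? a ×-dec yes g) (d , g)) (m≤m+n _ 0)
                ... | no ¬g = m≤n+m 1 _

            -- The class contains `a` itself, which `v a` leaves out. Since `near a` makes `v a`
            -- positive, doubling makes up for the difference.
            class-small : ∀ {a} → D a → count (λ a′ → S? a′ ×-dec ~-dec a′ r a) ≤ 2 * v a
            class-small {a} refl = begin
              count (λ a′ → S? a′ ×-dec ~-dec a′ r a)
                ≤⟨ ∑-mono pointwise ⟩
              ∑ (λ a′ → 𝟙 (near-set a a′) + 𝟙 (dec≡ a′ a))
                ≡⟨ ∑-+ (λ a′ → 𝟙 (near-set a a′)) (λ a′ → 𝟙 (dec≡ a′ a)) ⟩
              v a + count (λ a′ → dec≡ a′ a)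
                ≤⟨ +-monoʳ-≤ (v a) (≤-trans (count-single (λ a′ → dec≡ a′ a) (λ e e′ → trans e (sym e′)))
                                            (≤-trans (1≤v a) (m≤m+n (v a) 0))) ⟩
              2 * v a ∎
              where
              pointwise : ∀ a′ → 𝟙 (S? a′ ×-dec ~-dec a′ r a) ≤ 𝟙 (near-set a a′) + 𝟙 (dec≡ a′ a)
              pointwise a′ = 𝟙-≤ (S? a′ ×-dec ~-dec a′ r a) (λ (_ , q) → cases q (dec≡ a′ a))
                where
                cases : a′ ~[ r ] a → Dec (a′ ≡ a) → 1 ≤ 𝟙 (near-set a a′) + 𝟙 (dec≡ a′ a)
                cases q (yes e) = ≤-trans (𝟙-≥ (dec≡ a′ a) e) (m≤n+m _ _)
                cases q (no ¬e) = ≤-trans (𝟙-≥ (near-set a a′) (¬e , q)) (m≤m+n _ _)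

            E-small : E ≤ 2 * Σv
            E-small = begin
              E
                ≤⟨ ∑-mono (λ a → 𝟙*-≤ (S? a) (λ sa → ≤-trans (class-small (proj₁ sa))
                     (≤-trans (≤-reflexive (sym (*-identityˡ _))) (*-monoˡ-≤ (2 * v a) (𝟙-≥ (S? a) sa))))) ⟩
              ∑ (λ a → 𝟙 (S? a) * (2 * v a))
                ≡⟨ ∑-cong (λ a → lemma (𝟙 (S? a)) (v a)) ⟩
              ∑ (λ a → 2 * (𝟙 (S? a) * v a))
                ≡⟨ ∑-*ˡ 2 (λ a → 𝟙 (S? a) * v a) ⟩
              2 * Σv ∎
              where
              lemma : ∀ x y → x * (2 * y) ≡ 2 * (x * y)
              lemma = solve-∀

            row-eq : row G? separated b ≡ R * Σv
            row-eq = begin-equality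
              ∑ (λ a → 𝟙 (good? a b) * (v a * count (G? a)))
                ≡⟨ ∑-cong (λ a → cong (λ g → 𝟙 (good? a b) * (v a * g))
                     (trans (∑-cong (λ c → 𝟙-× (D? a) (rep? c))) (∑-*ˡ (𝟙 (D? a)) (λ c → 𝟙 (rep? c))))) ⟩
              ∑ (λ a → 𝟙 (good? a b) * (v a * (𝟙 (D? a) * R)))
                ≡⟨ ∑-cong (λ a → trans (lemma (𝟙 (good? a b)) (v a) (𝟙 (D? a)) R)
                     (cong (λ z → R * (z * v a)) (sym (𝟙-× (D? a) (good? a b))))) ⟩
              ∑ (λ a → R * (𝟙 (S? a) * v a))
                ≡⟨ ∑-*ˡ R (λ a → 𝟙 (S? a) * v a) ⟩
              R * Σv ∎
              where
              lemma : ∀ g v d r → g * (v * (d * r)) ≡ r * (d * g * v)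
              lemma = solve-∀

            -- The chain is `(3n/8)² ≤ M² ≤ R E ≤ 2 R Σv`; 9 is lowered to 8 so that the constants
            -- divide evenly.
            row-large : n * n ≤ 16 * row G? separated b
            row-large = *-cancelˡ-≤ 8 (begin
              8 * (n * n)                      ≤⟨ *-monoˡ-≤ (n * n) (n≤1+n 8) ⟩
              9 * (n * n)                      ≡⟨ square 3 n ⟨
              3 * n * (3 * n)                  ≤⟨ *-mono-≤ M-large M-large ⟩
              8 * M * (8 * M)                  ≡⟨ square 8 M ⟩
              64 * (M * M)                     ≤⟨ *-monoʳ-≤ 64 (related-pairs (λ x y → ~-dec x r y) S? rep?
                                                    (λ x y → ~-trans y (~-sym x)) (λ x y → ~-trans (~-sym x) y)
                                                    (λ sx → rep (proj₁ sx)) rep-unique) ⟩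
              64 * (R * E)                     ≤⟨ *-monoʳ-≤ 64 (*-monoʳ-≤ R E-small) ⟩
              64 * (R * (2 * Σv))              ≡⟨ lemma R Σv ⟩
              8 * (16 * (R * Σv))              ≡⟨ cong (λ z → 8 * (16 * z)) row-eq ⟨
              8 * (16 * row G? separated b)    ∎)
              where
              square : ∀ k m → k * m * (k * m) ≡ k * k * (m * m)
              square = solve-∀
              lemma : ∀ r v → 64 * (r * (2 * v)) ≡ 8 * (16 * (r * v))
              lemma = solve-∀

          tie-case : Conclusion
          tie-case = conclude G? separated row-large

        ties : ℕ
        ties = ∑ (λ a → count (λ c → ρ c ℤ.≟ ρ a))

        trichotomy : n * n ≤ 2 * strict-pairs + ties
        trichotomy = begin
          n * n
            ≡⟨ cong₂ _*_ (sym (card-Fin n)) (trans (sym (card-Fin n)) (sym (*-identityʳ _))) ⟩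
          card (Fin n) * (card (Fin n) * 1)
            ≡⟨ trans (∑-cong {Fin n} (λ _ → ∑-const {Fin n} 1)) (∑-const {Fin n} (card (Fin n) * 1)) ⟨
          ∑ {Fin n} (λ _ → ∑ {Fin n} (λ _ → 1))
            ≤⟨ ∑-mono (λ a → ∑-mono (λ c → pointwise a c)) ⟩
          ∑ (λ a → ∑ (λ c → 𝟙 (larger? a c) + (𝟙 (larger? c a) + 𝟙 (ρ c ℤ.≟ ρ a))))
            ≡⟨ ∑-cong (λ a → trans (∑-+ (λ c → 𝟙 (larger? a c)) (λ c → 𝟙 (larger? c a) + 𝟙 (ρ c ℤ.≟ ρ a)))
                 (cong (count (larger? a) +_) (∑-+ (λ c → 𝟙 (larger? c a)) (λ c → 𝟙 (ρ c ℤ.≟ ρ a))))) ⟩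
          ∑ (λ a → count (larger? a) + (count (λ c → larger? c a) + count (λ c → ρ c ℤ.≟ ρ a)))
            ≡⟨ trans (∑-+ (λ a → count (larger? a)) (λ a → count (λ c → larger? c a) + count (λ c → ρ c ℤ.≟ ρ a)))
                 (cong (strict-pairs +_) (∑-+ (λ a → count (λ c → larger? c a)) (λ a → count (λ c → ρ c ℤ.≟ ρ a)))) ⟩
          strict-pairs + (∑ (λ a → count (λ c → larger? c a)) + ties)
            ≡⟨ cong (λ z → strict-pairs + (z + ties)) (∑-swap (λ a c → 𝟙 (larger? c a))) ⟩
          strict-pairs + (strict-pairs + ties)
            ≡⟨ lemma strict-pairs ties ⟩
          2 * strict-pairs + ties ∎
          where
          lemma : ∀ x y → x + (x + y) ≡ 2 * x + y
          lemma = solve-∀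
          pointwise : ∀ a c → 1 ≤ 𝟙 (larger? a c) + (𝟙 (larger? c a) + 𝟙 (ρ c ℤ.≟ ρ a))
          pointwise a c with ℤ.<-cmp (ρ a) (ρ c)
          ... | tri< lt _ _ = ≤-trans (𝟙-≥ (larger? a c) lt) (m≤m+n _ _)
          ... | tri≈ _ eq _ = ≤-trans (𝟙-≥ (ρ c ℤ.≟ ρ a) (sym eq))
                                      (≤-trans (m≤n+m _ (𝟙 (larger? c a))) (m≤n+m _ (𝟙 (larger? a c))))
          ... | tri> _ _ gt = ≤-trans (𝟙-≥ (larger? c a) gt)
                                      (≤-trans (m≤m+n _ (𝟙 (ρ c ℤ.≟ ρ a))) (m≤n+m _ (𝟙 (larger? a c))))

        -- By trichotomy more than `n²/2` ordered pairs are ties, so some `a` ties with more than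
        -- `n/2` elements.
        common-radius : ¬ (n * n ≤ 4 * strict-pairs) → ∃ λ a → n < 2 * count (λ c → ρ c ℤ.≟ ρ a)
        common-radius ¬h = ∑-pigeonhole (λ a → 2 * count (λ c → ρ c ℤ.≟ ρ a)) n (begin-strict
          card (Fin n) * n                          ≡⟨ cong (_* n) (card-Fin n) ⟩
          n * n                                     <⟨ +-cancelʳ-< (n * n) _ _ excess ⟩
          2 * ties                                  ≡⟨ ∑-*ˡ 2 (λ a → count (λ c → ρ c ℤ.≟ ρ a)) ⟨
          ∑ (λ a → 2 * count (λ c → ρ c ℤ.≟ ρ a))   ∎)
          where
          lemma : ∀ x y → 2 * x + y + (2 * x + y) ≡ 2 * y + 4 * x
          lemma = solve-∀
          excess : n * n + n * n < 2 * ties + n * n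
          excess = begin-strict
            n * n + n * n                                        ≤⟨ +-mono-≤ trichotomy trichotomy ⟩
            2 * strict-pairs + ties + (2 * strict-pairs + ties)  ≡⟨ lemma strict-pairs ties ⟩
            2 * ties + 4 * strict-pairs                          <⟨ +-monoʳ-< (2 * ties) (≰⇒> ¬h) ⟩
            2 * ties + n * n                                     ∎

      pair-bound : n * (n * n * n) ≤ κ * (p * p) * s * 256
      pair-bound = ≤-trans unflipped (≤-reflexive (*-comm 256 (κ * (p * p) * s)))
        where
        unflipped : Conclusion
        unflipped with n * n ≤? 4 * strict-pairs
        ... | yes h = strict-case h
        ... | no ¬h with a , big ← common-radius ¬h = Tie.tie-case (ρ a) (<⇒≤ big)

-- The bound n κ² ≪ q² L² s.

module ShiftBound where

  open FiniteSums
  open BallSystems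
  open import Data.Empty using (⊥-elim)
  open import Data.Fin using (Fin; fromℕ<)
  open import Data.Fin.Properties using (toℕ-fromℕ<)
  open import Data.Integer as ℤ using (ℤ)
  import Data.Integer.Properties as ℤ
  open import Data.Nat using (ℕ; suc; _+_; _*_; _≤_; _<_; z≤n; s≤s; _≤?_; >-nonZero)
  open import Data.Nat.Logarithm using (⌊log₂_⌋; ⌊log₂⌋-mono-≤; ⌊log₂[2*b]⌋≡1+⌊log₂b⌋)
  open import Data.Nat.Properties
  open import Data.Nat.Tactic.RingSolver using (solve-∀)
  open import Data.Product using (∃; _×_; _,_; proj₁; proj₂)
  open import Data.Sum using (_⊎_; inj₁; inj₂; map)
  open import Data.Unit using (⊤; tt)
  open import Function using (_∘_)
  open import Relation.Binary using (tri<; tri≈; tri>)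
  open import Relation.Binary.PropositionalEquality
  open import Relation.Nullary using (¬_; Dec; yes; no)
  open import Relation.Nullary.Decidable using (_×-dec_; ¬?)
  open import Relation.Unary using (Decidable)

  module _ {s : ℕ} (balls : BallSystem (Fin s)) where

    open BallSystem balls

    -- Shift z a y stands for z + a - u = y in a set with s elements.
    module _
      {n q : ℕ}
      (ρ : Fin n → ℤ) {Q : Fin n → Set} (Q? : Decidable Q) (u : Fin n) (Qu : Q u)
      (digit : Fin n → Fin q)
      (digit-inj : ∀ {a a′} → Q a → Q a′ → ρ a ≡ ρ a′ → digit a ≡ digit a′ → a ≡ a′)
      (Shift : Fin s → Fin n → Fin s → Set)
      (shift-inj : ∀ {z z′ a y} → Shift z a y → Shift z′ a y → z ≡ z′)
      (shift-close : ∀ {z a y} → Q a → Shift z a y → z ~[ ρ a ] y)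
      (shift-far : ∀ {z a y r} → Q a → a ≢ u → r ℤ.< ρ a → Shift z a y → ¬ z ~[ r ] y)
      where

      private
        open ≤-Reasoning

        -- The number of values of `⌊log₂ N ⌋` for `N` between 1 and `s`.
        L : ℕ
        L = suc ⌊log₂ s ⌋

        Q′? : Decidable (λ a → Q a × a ≢ u)
        Q′? a = Q? a ×-dec ¬? (dec≡ a u)

      module _ {X Y : Fin s → Set} (X? : Decidable X) (Y? : Decidable Y) (X⊆Y : ∀ {z} → X z → Y z)
               (step : ∀ {z a} → X z → Q a → ∃ λ y → Y y × Shift z a y) where

        private
          -- `step` takes proofs as arguments; this is its total version on indices, with `z` as a
          -- placeholder outside `X` and `Q`.
          sh : Fin s → Fin n → Fin s
          sh z a with X? z | Q? a
          ... | yes x | yes h = proj₁ (step x h)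
          ... | _     | _     = z

          sh-spec : ∀ {z a} → X z → Q a → Y (sh z a) × Shift z a (sh z a)
          sh-spec {z} {a} x h with X? z | Q? a
          ... | yes x | yes h = proj₂ (step x h)
          ... | no ¬x | _     = ⊥-elim (¬x x)
          ... | yes _ | no ¬h = ⊥-elim (¬h h)

          near? : ∀ z r → Decidable (λ y → Y y × z ~[ r ] y)
          near? z r y = Y? y ×-dec ~-dec z r y

          N : Fin s → ℤ → ℕ
          N z r = count (near? z r)

          N-mono : ∀ z {r r′} → r ℤ.≤ r′ → N z r ≤ N z r′
          N-mono z {r} {r′} le = count-mono (near? z r) (near? z r′) (λ (y , h) → y , ~-mono le h)

          Halves : Fin s → Fin n → Set
          Halves z a = 2 * N z (ℤ.pred (ρ a)) ≤ N z (ρ a)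

          halves? : ∀ z a → Dec (Halves z a)
          halves? z a = 2 * N z (ℤ.pred (ρ a)) ≤? N z (ρ a)

          pred< : ∀ r → ℤ.pred r ℤ.< r
          pred< r = ℤ.i≤pred[j]⇒i<j ℤ.≤-refl

          N≤s : ∀ z r → N z r ≤ s
          N≤s z r = ≤-trans (count≤card (near? z r)) (≤-reflexive (card-Fin s))

          level : Fin s → Fin n → Fin L
          level z a = fromℕ< (s≤s (⌊log₂⌋-mono-≤ (N≤s z (ρ a))))

          -- Degrees are integers, so `ρ a ≤ ρ a′ - 1`, and halving at `a′` makes the count at
          -- `ρ a′` at least twice that at `ρ a`: the logarithm grows by one. The point `z`, being
          -- in `Y`, keeps the smaller count positive.
          level-strict : ∀ {z a a′} → Y z → Halves z a′ → ρ a ℤ.< ρ a′ → level z a ≢ level z a′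
          level-strict {z} {a} {a′} y h lt eq = <-irrefl log-eq (begin
            suc ⌊log₂ N z (ρ a) ⌋     ≡⟨ ⌊log₂[2*b]⌋≡1+⌊log₂b⌋ (N z (ρ a)) {{>-nonZero positive}} ⟨
            ⌊log₂ (2 * N z (ρ a)) ⌋   ≤⟨ ⌊log₂⌋-mono-≤ doubled ⟩
            ⌊log₂ N z (ρ a′) ⌋        ∎)
            where
            positive : 1 ≤ N z (ρ a)
            positive = count>0 (near? z (ρ a)) (y , ~-refl)
            doubled : 2 * N z (ρ a) ≤ N z (ρ a′)
            doubled = ≤-trans (*-monoʳ-≤ 2 (N-mono z (ℤ.i<j⇒i≤pred[j] lt))) h
            log-eq : ⌊log₂ N z (ρ a) ⌋ ≡ ⌊log₂ N z (ρ a′) ⌋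
            log-eq = trans (sym (toℕ-fromℕ< _)) (trans (cong Data.Fin.toℕ eq) (toℕ-fromℕ< _))

          -- Along the radii that halve at z, log₂ (N z r) is strictly increasing.
          halvings-few : ∀ {z} → Y z → count (λ a → Q? a ×-dec halves? z a) ≤ L * q
          halvings-few {z} y = begin
            count (λ a → Q? a ×-dec halves? z a)
              ≤⟨ count-inj (λ a → Q? a ×-dec halves? z a) (λ (_ : Fin L × Fin q) → yes tt)
                   (λ a → level z a , digit a) (λ _ → tt) injective ⟩
            count (λ (_ : Fin L × Fin q) → yes tt)
              ≤⟨ count≤card (λ (_ : Fin L × Fin q) → yes tt) ⟩
            card (Fin L × Fin q)
              ≡⟨ card-× (Fin L) (Fin q) ⟩
            card (Fin L) * card (Fin q)
              ≡⟨ cong₂ _*_ (card-Fin L) (card-Fin q) ⟩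
            L * q ∎
            where
            injective : ∀ {a a′} → Q a × Halves z a → Q a′ × Halves z a′ →
                        (level z a , digit a) ≡ (level z a′ , digit a′) → a ≡ a′
            injective {a} {a′} (h , half) (h′ , half′) e with ℤ.<-cmp (ρ a) (ρ a′)
            ... | tri< lt _ _ = ⊥-elim (level-strict y half′ lt (cong proj₁ e))
            ... | tri≈ _ eq _ = digit-inj h h′ eq (cong proj₂ e)
            ... | tri> _ _ gt = ⊥-elim (level-strict y half gt (sym (cong proj₁ e)))

          -- Two ultrametric balls of the same degree are equal or disjoint; here both lie in the
          -- ball of degree `r` around `z`.
          disjoint : ∀ {z y r} → z ~[ r ] y → ¬ z ~[ ℤ.pred r ] y →
                     N z (ℤ.pred r) + N y (ℤ.pred r) ≤ N z r
          disjoint {z} {y} {r} close far = begin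
            N z (ℤ.pred r) + N y (ℤ.pred r)
              ≡⟨ ∑-+ (λ w → 𝟙 (near? z (ℤ.pred r) w)) (λ w → 𝟙 (near? y (ℤ.pred r) w)) ⟨
            ∑ (λ w → 𝟙 (near? z (ℤ.pred r) w) + 𝟙 (near? y (ℤ.pred r) w))
              ≤⟨ ∑-mono (λ w → 𝟙-disjoint (near? z (ℤ.pred r) w) (near? y (ℤ.pred r) w) (near? z r w)
                   (λ (_ , zw) (_ , yw) → far (~-trans zw (~-sym yw)))
                   (λ (Yw , zw) → Yw , ~-mono (ℤ.<⇒≤ (pred< r)) zw)
                   (λ (Yw , yw) → Yw , ~-trans close (~-mono (ℤ.<⇒≤ (pred< r)) yw))) ⟩
            N z r ∎

          -- The balls of degree ρ a - 1 around z and its shift are disjoint, so one of them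
          -- contains at most half of their common ball of degree ρ a.
          one-halves : ∀ {z a} → X z → Q a → a ≢ u → Halves z a ⊎ Halves (sh z a) a
          one-halves {z} {a} x h a≢u with ≤-total (N z (ℤ.pred (ρ a))) (N (sh z a) (ℤ.pred (ρ a)))
          ... | inj₁ le = inj₁ (≤-trans (+-monoʳ-≤ _ (≤-trans (≤-reflexive (+-identityʳ _)) le))
            (disjoint (shift-close h (proj₂ (sh-spec x h))) (shift-far h a≢u (pred< _) (proj₂ (sh-spec x h)))))
          ... | inj₂ le = inj₂ (≤-trans (+-monoʳ-≤ _ (≤-trans (≤-reflexive (+-identityʳ _)) le))
            (disjoint (~-sym (shift-close h (proj₂ (sh-spec x h))))
                      (shift-far h a≢u (pred< _) (proj₂ (sh-spec x h)) ∘ ~-sym)))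

        -- Each pair of a point and a shift halves at its source or at its target, which gives the
        -- factor 2. Pairs of the second kind are moved to their target; this is injective because
        -- the shift by a fixed `a - u` is.
        shift-growth : count X? * count Q′? ≤ 2 * (count Y? * (L * q))
        shift-growth = begin
          count X? * count Q′?
            ≡⟨ ∑*∑ (λ z → 𝟙 (X? z)) (λ a → 𝟙 (Q′? a)) ⟩
          ∑ (λ z → ∑ (λ a → 𝟙 (X? z) * 𝟙 (Q′? a)))
            ≡⟨ trans (∑-× (λ e → 𝟙 (edge? e))) (∑-cong (λ z → ∑-cong (λ a → 𝟙-× (X? z) (Q′? a)))) ⟨
          count edge?
            ≤⟨ ∑-mono (λ e@(z , a) → 𝟙-union (at-source? e) (at-target? e) (edge? e)
                 (λ (x , h , a≢u) → map (λ half → x , h , half) (λ half → x , h , half) (one-halves x h a≢u))) ⟩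
          ∑ (λ e → 𝟙 (at-source? e) + 𝟙 (at-target? e))
            ≡⟨ ∑-+ (λ e → 𝟙 (at-source? e)) (λ e → 𝟙 (at-target? e)) ⟩
          count at-source? + count at-target?
            ≤⟨ +-mono-≤ (count-mono at-source? halving? (λ (x , h) → X⊆Y x , h))
                 (≤-trans (count-inj at-target? halving? (λ (z , a) → sh z a , a)
                   (λ (x , h , half) → proj₁ (sh-spec x h) , h , half) injective) (m≤m+n _ 0)) ⟩
          2 * count halving?
            ≡⟨ cong (2 *_) (trans (∑-× (λ e → 𝟙 (halving? e))) (∑-cong (λ z → trans
                 (∑-cong (λ a → 𝟙-× (Y? z) (Q? a ×-dec halves? z a)))
                 (∑-*ˡ (𝟙 (Y? z)) (λ a → 𝟙 (Q? a ×-dec halves? z a)))))) ⟩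
          2 * ∑ (λ z → 𝟙 (Y? z) * count (λ a → Q? a ×-dec halves? z a))
            ≤⟨ *-monoʳ-≤ 2 (∑-mono (λ z → 𝟙*-≤ (Y? z) (λ y → ≤-trans (halvings-few y)
                 (≤-trans (≤-reflexive (sym (*-identityˡ (L * q)))) (*-monoˡ-≤ (L * q) (𝟙-≥ (Y? z) y)))))) ⟩
          2 * ∑ (λ z → 𝟙 (Y? z) * (L * q))
            ≡⟨ cong (2 *_) (∑-*ʳ (L * q) (λ z → 𝟙 (Y? z))) ⟩
          2 * (count Y? * (L * q)) ∎
          where
          edge? : Decidable (λ ((z , a) : Fin s × Fin n) → X z × Q a × a ≢ u)
          edge? (z , a) = X? z ×-dec Q′? a
          at-source? : Decidable (λ ((z , a) : Fin s × Fin n) → X z × Q a × Halves z a)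
          at-source? (z , a) = X? z ×-dec (Q? a ×-dec halves? z a)
          at-target? : Decidable (λ ((z , a) : Fin s × Fin n) → X z × Q a × Halves (sh z a) a)
          at-target? (z , a) = X? z ×-dec (Q? a ×-dec halves? (sh z a) a)
          halving? : Decidable (λ ((z , a) : Fin s × Fin n) → Y z × Q a × Halves z a)
          halving? (z , a) = Y? z ×-dec (Q? a ×-dec halves? z a)
          injective : ∀ {e@(z , a) e′@(z′ , a′) : Fin s × Fin n} →
            X z × Q a × Halves (sh z a) a → X z′ × Q a′ × Halves (sh z′ a′) a′ →
            (sh z a , a) ≡ (sh z′ a′ , a′) → e ≡ e′
          injective {z , a} {z′ , a′} (x , h , _) (x′ , h′ , _) e with refl ← cong proj₂ e =
            cong (_, a) (shift-inj (subst (Shift z a) (cong proj₁ e) (proj₂ (sh-spec x h)))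
                                   (proj₂ (sh-spec x′ h)))

      module _ (sd : Fin n → Fin n → Fin n → Fin s)
               (sd-cancel : ∀ {e e′} → sd u u e ≡ sd u u e′ → e ≡ e′)
               (shift₁ : ∀ {e a} → Shift (sd u u e) a (sd a u e))
               (shift₂ : ∀ {e a a′} → Shift (sd a u e) a′ (sd a a′ e)) where

        private
          X₀ X₁ : Fin s → Set
          X₀ z = ∃ λ e → z ≡ sd u u e
          X₁ z = ∃ λ ((a , e) : Fin n × Fin n) → Q a × z ≡ sd a u e

          X₀? : Decidable X₀
          X₀? z = any? (λ e → dec≡ z (sd u u e))

          X₁? : Decidable X₁
          X₁? z = any? (λ (a , e) → Q? a ×-dec dec≡ z (sd a u e))

          all : Decidable {A = Fin s} (λ _ → ⊤)
          all _ = yes tt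

          first : count X₀? * count Q′? ≤ 2 * (count X₁? * (L * q))
          -- The inclusion of `X₀` in `X₁` is the case `a = u`, by `Qu`.
          first = shift-growth X₀? X₁? (λ (e , z≡) → (u , e) , Qu , z≡)
            (λ { {a = a} (e , refl) h → sd a u e , ((a , e) , h , refl) , shift₁ })

          second : count X₁? * count Q′? ≤ 2 * (count all * (L * q))
          second = shift-growth X₁? all (λ _ → tt)
            (λ { {a = a′} ((a , e) , h , refl) h′ → sd a a′ e , tt , shift₂ })

          n≤X₀ : n ≤ count X₀?
          n≤X₀ = begin
            n                                     ≡⟨ card-Fin n ⟨
            card (Fin n)                          ≡⟨ *-identityʳ _ ⟨
            card (Fin n) * 1                      ≡⟨ ∑-const {Fin n} 1 ⟨
            count {X = Fin n} (λ _ → yes tt)      ≤⟨ count-inj (λ _ → yes tt) X₀? (λ e → sd u u e)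
                                                       (λ {e} _ → e , refl) (λ _ _ → sd-cancel) ⟩
            count X₀?                             ∎

          k : ℕ
          k = count Q′?

          -- Each of the two stages, from `X₀` to `X₁` and from `X₁` to everything, costs `2 L q`
          -- and gains `k`; hence the squares of `q` and `L`.
          n*k*k : n * (k * k) ≤ 4 * (s * (L * q * (L * q)))
          n*k*k = begin
            n * (k * k)                           ≡⟨ *-assoc n k k ⟨
            n * k * k                             ≤⟨ *-monoˡ-≤ k (≤-trans (*-monoˡ-≤ k n≤X₀) first) ⟩
            2 * (count X₁? * (L * q)) * k         ≡⟨ lemma (count X₁?) (L * q) k ⟩
            2 * (L * q) * (count X₁? * k)         ≤⟨ *-monoʳ-≤ (2 * (L * q)) second ⟩
            2 * (L * q) * (2 * (count all * (L * q)))
                                                  ≤⟨ *-monoʳ-≤ (2 * (L * q)) (*-monoʳ-≤ 2 (*-monoˡ-≤ (L * q)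
                                                       (≤-trans (count≤card all) (≤-reflexive (card-Fin s))))) ⟩
            2 * (L * q) * (2 * (s * (L * q)))     ≡⟨ lemma₂ s (L * q) ⟩
            4 * (s * (L * q * (L * q)))           ∎
            where
            lemma : ∀ x l k → 2 * (x * l) * k ≡ 2 * l * (x * k)
            lemma = solve-∀
            lemma₂ : ∀ s l → 2 * l * (2 * (s * l)) ≡ 4 * (s * (l * l))
            lemma₂ = solve-∀

          Q-split : count Q? ≤ k + 1
          Q-split = begin
            count Q?                              ≤⟨ ∑-mono (λ a → 𝟙-union (Q′? a) (dec≡ a u) (Q? a) (cases a)) ⟩
            ∑ (λ a → 𝟙 (Q′? a) + 𝟙 (dec≡ a u))    ≡⟨ ∑-+ (λ a → 𝟙 (Q′? a)) (λ a → 𝟙 (dec≡ a u)) ⟩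
            k + count (λ a → dec≡ a u)            ≤⟨ +-monoʳ-≤ k (count-single (λ a → dec≡ a u) (λ e e′ → trans e (sym e′))) ⟩
            k + 1                                 ∎
            where
            cases : ∀ a → Q a → (Q a × a ≢ u) ⊎ a ≡ u
            cases a h with dec≡ a u
            ... | yes e = inj₂ e
            ... | no ¬e = inj₁ (h , ¬e)

        -- Leaving `u` out of `Q` costs one element. If others remain, `k + 1 ≤ 2 k` and the
        -- constant is 4 · 4. If not, shifting gives nothing, but `2u - A` already shows `n ≤ s`.
        shift-bound : n * (count Q? * count Q?) ≤ s * (L * q * (L * q)) * 16
        shift-bound with 1 ≤? k
        ... | yes 1≤k = begin
          n * (count Q? * count Q?)               ≤⟨ *-monoʳ-≤ n (*-mono-≤ Q≤2k Q≤2k) ⟩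
          n * (2 * k * (2 * k))                   ≡⟨ lemma n k ⟩
          4 * (n * (k * k))                       ≤⟨ *-monoʳ-≤ 4 n*k*k ⟩
          4 * (4 * (s * (L * q * (L * q))))       ≡⟨ *-assoc 4 4 (s * (L * q * (L * q))) ⟨
          16 * (s * (L * q * (L * q)))            ≡⟨ *-comm 16 (s * (L * q * (L * q))) ⟩
          s * (L * q * (L * q)) * 16              ∎
          where
          lemma : ∀ n k → n * (2 * k * (2 * k)) ≡ 4 * (n * (k * k))
          lemma = solve-∀
          Q≤2k : count Q? ≤ 2 * k
          Q≤2k = ≤-trans Q-split (+-monoʳ-≤ k (≤-trans 1≤k (m≤m+n k 0)))
        ... | no k<1 = begin
          n * (count Q? * count Q?)               ≤⟨ *-monoʳ-≤ n (*-mono-≤ Q≤1 Q≤1) ⟩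
          n * 1                                   ≤⟨ *-mono-≤ n≤s (*-mono-≤ 1≤Lq 1≤Lq) ⟩
          s * (L * q * (L * q))                   ≤⟨ m≤n*m _ 16 ⟩
          16 * (s * (L * q * (L * q)))            ≡⟨ *-comm 16 (s * (L * q * (L * q))) ⟩
          s * (L * q * (L * q)) * 16              ∎
          where
          Q≤1 : count Q? ≤ 1
          Q≤1 = ≤-trans Q-split (+-monoˡ-≤ 1 (≤-reflexive (n<1⇒n≡0 (≰⇒> k<1))))
          n≤s : n ≤ s
          n≤s = ≤-trans n≤X₀ (≤-trans (count≤card X₀?) (≤-reflexive (card-Fin s)))
          1≤Lq : 1 ≤ L * q
          1≤Lq = *-mono-≤ (s≤s (z≤n {⌊log₂ s ⌋})) (Fin⇒1≤ (digit u))

-- Eliminating κ and absorbing the logarithm.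

module LogarithmBound where

  open import Data.Nat using (ℕ; zero; suc; _+_; _*_; _^_; _≤_; z≤n; s≤s; _≤?_; NonZero; >-nonZero)
  open import Data.Nat.DivMod using (_/_; _%_; m≡m%n+[m/n]*n; m%n<n; m/n*n≤m)
  open import Data.Nat.Logarithm using (⌊log₂_⌋; ⌊log₂⌋-mono-≤; ⌊log₂[2^n]⌋≡n)
  open import Data.Nat.Properties
  open import Data.Nat.Tactic.RingSolver using (solve-∀)
  open import Data.Product using (∃; _×_; _,_)
  open import Relation.Binary.PropositionalEquality
  open import Relation.Nullary using (yes; no)

  open ≤-Reasoning

  ^-distribʳ-* : ∀ x y n → (x * y) ^ n ≡ x ^ n * y ^ n
  ^-distribʳ-* x y zero    = refl
  ^-distribʳ-* x y (suc n) = trans (cong (x * y *_) (^-distribʳ-* x y n)) (lemma x y (x ^ n) (y ^ n))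
    where
    lemma : ∀ x y a b → x * y * (a * b) ≡ x * a * (y * b)
    lemma = solve-∀

  1≤m^n : ∀ {m} → 1 ≤ m → ∀ n → 1 ≤ m ^ n
  1≤m^n {suc m} _ n = m^n>0 (suc m) n

  1+n≤2^n : ∀ n → suc n ≤ 2 ^ n
  1+n≤2^n zero    = s≤s z≤n
  1+n≤2^n (suc n) = begin
    suc (suc n)      ≤⟨ s≤s (m≤n+m (suc n) n) ⟩
    suc n + suc n    ≤⟨ +-mono-≤ (1+n≤2^n n) (≤-trans (1+n≤2^n n) (m≤m+n _ 0)) ⟩
    2 ^ suc n        ∎

  -- Division with remainder gives `suc m ≤ d * suc (m / d) ≤ d * 2 ^ (m /
  -- d)`, and the `d`-th power of the last factor is at most `2 ^ m`.
  power≤exponential : ∀ d .{{_ : NonZero d}} m → suc m ^ d ≤ d ^ d * 2 ^ m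
  power≤exponential d m = begin
    suc m ^ d                     ≤⟨ ^-monoˡ-≤ d base ⟩
    (d * 2 ^ (m / d)) ^ d         ≡⟨ ^-distribʳ-* d (2 ^ (m / d)) d ⟩
    d ^ d * (2 ^ (m / d)) ^ d     ≡⟨ cong (d ^ d *_) (^-*-assoc 2 (m / d) d) ⟩
    d ^ d * 2 ^ (m / d * d)       ≤⟨ *-monoʳ-≤ (d ^ d) (^-monoʳ-≤ 2 (m/n*n≤m m d)) ⟩
    d ^ d * 2 ^ m                 ∎
    where
    base : suc m ≤ d * 2 ^ (m / d)
    base = begin
      suc m                       ≡⟨ cong suc (m≡m%n+[m/n]*n m d) ⟩
      suc (m % d) + m / d * d     ≤⟨ +-monoˡ-≤ (m / d * d) (m%n<n m d) ⟩
      d + m / d * d               ≡⟨ *-comm (suc (m / d)) d ⟩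
      d * suc (m / d)             ≤⟨ *-monoʳ-≤ d (1+n≤2^n (m / d)) ⟩
      d * 2 ^ (m / d)             ∎

  dyadic : ∀ n → 1 ≤ n → ∃ λ m → 2 ^ m ≤ n × n ≤ 2 ^ suc m
  dyadic (suc zero)    _ = 0 , s≤s z≤n , s≤s z≤n
  dyadic (suc (suc n)) _ with m , lo , hi ← dyadic (suc n) (s≤s z≤n) with suc (suc n) ≤? 2 ^ suc m
  ... | yes h = m , m≤n⇒m≤1+n lo , h
  ... | no ¬h = suc m , <⇒≤ (≰⇒> ¬h) , (begin
    suc (suc n)                 ≤⟨ s≤s hi ⟩
    suc (2 ^ suc m)             ≤⟨ +-monoˡ-≤ (2 ^ suc m) (1≤m^n {2} (s≤s z≤n) (suc m)) ⟩
    2 ^ suc m + 2 ^ suc m       ≡⟨ cong (2 ^ suc m +_) (sym (+-identityʳ _)) ⟩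
    2 ^ suc (suc m)             ∎)

  -- With `n ≤ 2 ^ suc m`, the cube gives `⌊log₂ s ⌋ ≤ 3 (m + 1)`, and the additional 1 makes the
  -- factor 4. Any fixed power of the logarithm is thus linear in `n`.
  log-bound : ∀ d .{{_ : NonZero d}} {n s} → 1 ≤ n → s ≤ n ^ 3 →
              suc ⌊log₂ s ⌋ ^ d ≤ 4 ^ d * d ^ d * n
  log-bound d {n} {s} 1≤n s≤n³ with m , lo , hi ← dyadic n 1≤n = begin
    suc ⌊log₂ s ⌋ ^ d             ≤⟨ ^-monoˡ-≤ d log ⟩
    (4 * suc m) ^ d               ≡⟨ ^-distribʳ-* 4 (suc m) d ⟩
    4 ^ d * suc m ^ d             ≤⟨ *-monoʳ-≤ (4 ^ d) (power≤exponential d m) ⟩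
    4 ^ d * (d ^ d * 2 ^ m)       ≡⟨ *-assoc (4 ^ d) (d ^ d) (2 ^ m) ⟨
    4 ^ d * d ^ d * 2 ^ m         ≤⟨ *-monoʳ-≤ (4 ^ d * d ^ d) lo ⟩
    4 ^ d * d ^ d * n             ∎
    where
    log : suc ⌊log₂ s ⌋ ≤ 4 * suc m
    log = begin
      suc ⌊log₂ s ⌋                    ≤⟨ s≤s (⌊log₂⌋-mono-≤ (≤-trans s≤n³ (^-monoˡ-≤ 3 hi))) ⟩
      suc ⌊log₂ (2 ^ suc m) ^ 3 ⌋      ≡⟨ cong (λ z → suc ⌊log₂ z ⌋) (^-*-assoc 2 (suc m) 3) ⟩
      suc ⌊log₂ 2 ^ (suc m * 3) ⌋      ≡⟨ cong suc (⌊log₂[2^n]⌋≡n (suc m * 3)) ⟩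
      suc (suc m * 3)                  ≤⟨ +-monoˡ-≤ (suc m * 3) (s≤s (z≤n {m})) ⟩
      suc m + suc m * 3                ≡⟨ lemma (suc m) ⟩
      4 * suc m                        ∎
      where
      lemma : ∀ m → m + m * 3 ≡ 4 * m
      lemma = solve-∀

  -- n⁹ = n (n⁴)² ≤ c² p⁴ s² (n κ²)
  ninth-power-bound : ∀ c d {n p s κ q L} →
            n * (n * n * n) ≤ κ * (p * p) * s * c →
            n * (κ * κ) ≤ s * (L * q * (L * q)) * d →
            n ^ 9 ≤ q ^ 2 * s ^ 3 * p ^ 4 * L ^ 2 * (c * c * d)
  ninth-power-bound c d {n} {p} {s} {κ} {q} {L} P S = begin
    n ^ 9
      ≡⟨ lhs n ⟩
    n * (n * (n * n * n) * (n * (n * n * n)))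
      ≤⟨ *-monoʳ-≤ n (*-mono-≤ P P) ⟩
    n * (κ * (p * p) * s * c * (κ * (p * p) * s * c))
      ≡⟨ middle c n κ p s ⟩
    c * c * (p * p * s * (p * p * s)) * (n * (κ * κ))
      ≤⟨ *-monoʳ-≤ (c * c * (p * p * s * (p * p * s))) S ⟩
    c * c * (p * p * s * (p * p * s)) * (s * (L * q * (L * q)) * d)
      ≡⟨ rhs c d p s q L ⟩
    q ^ 2 * s ^ 3 * p ^ 4 * L ^ 2 * (c * c * d) ∎
    where
    lhs : ∀ n → n * (n * (n * (n * (n * (n * (n * (n * (n * 1)))))))) ≡ n * (n * (n * n * n) * (n * (n * n * n)))
    lhs = solve-∀
    middle : ∀ c n κ p s → n * (κ * (p * p) * s * c * (κ * (p * p) * s * c))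
                           ≡ c * c * (p * p * s * (p * p * s)) * (n * (κ * κ))
    middle = solve-∀
    rhs : ∀ c d p s q L → c * c * (p * p * s * (p * p * s)) * (s * (L * q * (L * q)) * d)
      ≡ q * (q * 1) * (s * (s * (s * 1))) * (p * (p * (p * (p * 1)))) * (L * (L * 1)) * (c * c * d)
    rhs = solve-∀

  m≤m^n : ∀ {m n} → 1 ≤ m → 1 ≤ n → m ≤ m ^ n
  m≤m^n {m} {n} 1≤m 1≤n = ≤-trans (≤-reflexive (sym (^-identityʳ m)))
                                  (^-monoʳ-≤ m {{>-nonZero 1≤m}} 1≤n)

  -- The constant of `log-bound` for the exponent `2 * b`, to which `L` appears once `L ^ 2` has
  -- been raised to the power `b`.
  logConstant : ℕ → ℕ
  logConstant b = 4 ^ (2 * b) * (2 * b) ^ (2 * b)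

  1≤logConstant : ∀ {b} → 1 ≤ b → 1 ≤ logConstant b
  1≤logConstant {b} 1≤b = *-mono-≤ (1≤m^n {4} (s≤s z≤n) (2 * b)) (1≤m^n (*-mono-≤ (s≤s (z≤n {1})) 1≤b) (2 * b))

  -- All is raised to the power `b` to make `ε = a / b` an integral exponent. The logarithmic factor
  -- `L ^ (2 * b)` is then at most a constant times `n`, hence times `n ^ a`.
  absorb-log : ∀ {a b C n q s p} → 1 ≤ a → 1 ≤ b → 1 ≤ C → 1 ≤ q → (1 ≤ n → 1 ≤ s) → (1 ≤ n → 1 ≤ p) →
    (2 ≤ n → n ^ 9 ≤ q ^ 2 * s ^ 3 * p ^ 4 * suc ⌊log₂ s ⌋ ^ 2 * C) →
    1 ^ b * n ^ (9 * b) ≤ (logConstant b * C) ^ b * q ^ (2 * b) * s ^ (3 * b) * p ^ (4 * b) * n ^ a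
  -- Matching `b` as a successor lets `0 ^ (9 * b)` compute to 0.
  absorb-log {b = b@(suc _)} {n = zero} _ _ _ _ _ _ _ =
    ≤-trans (≤-reflexive (*-zeroʳ (1 ^ b))) z≤n
  absorb-log {a} {b} {C} {n@(suc n-1)} {q} {s} {p} 1≤a 1≤b 1≤C 1≤q s-pos p-pos h = begin
    1 ^ b * n ^ (9 * b)           ≡⟨ trans (cong (_* n ^ (9 * b)) (^-zeroˡ b)) (*-identityˡ _) ⟩
    n ^ (9 * b)                   ≡⟨ ^-*-assoc n 9 b ⟨
    (n ^ 9) ^ b                   ≤⟨ bound ⟩
    (K * C) ^ b * q ^ (2 * b) * s ^ (3 * b) * p ^ (4 * b) * n ^ a ∎
    where
    K = logConstant b
    L = suc ⌊log₂ s ⌋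
    1≤s = s-pos (s≤s z≤n)
    1≤p = p-pos (s≤s z≤n)
    R = (K * C) ^ b * q ^ (2 * b) * s ^ (3 * b) * p ^ (4 * b) * n ^ a

    -- Serves both `s > n³` and `n = 1`; the remaining factors on the right need only be at least 1.
    cubes : n ^ 9 ≤ s ^ 3 → (n ^ 9) ^ b ≤ R
    cubes n⁹≤s³ = begin
      (n ^ 9) ^ b                 ≤⟨ ^-monoˡ-≤ b n⁹≤s³ ⟩
      (s ^ 3) ^ b                 ≡⟨ ^-*-assoc s 3 b ⟩
      s ^ (3 * b)                 ≡⟨ lemma (s ^ (3 * b)) ⟩
      1 * s ^ (3 * b) * 1 * 1     ≤⟨ *-mono-≤ (*-mono-≤ (*-monoˡ-≤ (s ^ (3 * b))
                                       (*-mono-≤ (1≤m^n (*-mono-≤ (1≤logConstant 1≤b) 1≤C) b) (1≤m^n 1≤q (2 * b))))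
                                       (1≤m^n 1≤p (4 * b))) (1≤m^n (s≤s (z≤n {n-1})) a) ⟩
      R                           ∎
      where
      lemma : ∀ x → x ≡ 1 * x * 1 * 1
      lemma = solve-∀

    main : s ≤ n ^ 3 → 2 ≤ n → (n ^ 9) ^ b ≤ R
    main s≤n³ 2≤n = begin
      (n ^ 9) ^ b
        ≤⟨ ^-monoˡ-≤ b (h 2≤n) ⟩
      (q ^ 2 * s ^ 3 * p ^ 4 * L ^ 2 * C) ^ b
        ≡⟨ ^-distribʳ-* (q ^ 2 * s ^ 3 * p ^ 4 * L ^ 2) C b ⟩
      (q ^ 2 * s ^ 3 * p ^ 4 * L ^ 2) ^ b * C ^ b
        ≡⟨ cong (_* C ^ b) (trans (^-distribʳ-* (q ^ 2 * s ^ 3 * p ^ 4) (L ^ 2) b) (cong₂ _*_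
             (trans (^-distribʳ-* (q ^ 2 * s ^ 3) (p ^ 4) b) (cong₂ _*_
               (trans (^-distribʳ-* (q ^ 2) (s ^ 3) b) (cong₂ _*_ (^-*-assoc q 2 b) (^-*-assoc s 3 b)))
               (^-*-assoc p 4 b)))
             (^-*-assoc L 2 b))) ⟩
      q ^ (2 * b) * s ^ (3 * b) * p ^ (4 * b) * L ^ (2 * b) * C ^ b
        ≤⟨ *-monoˡ-≤ (C ^ b) (*-monoʳ-≤ (q ^ (2 * b) * s ^ (3 * b) * p ^ (4 * b))
             (≤-trans (log-bound (2 * b) {{>-nonZero (*-mono-≤ (s≤s (z≤n {1})) 1≤b)}} {n} (s≤s z≤n) s≤n³)
                      -- `K ≤ K ^ b` and `n ≤ n ^ a` bring the bound into the form of the goal.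
                      (*-mono-≤ (m≤m^n (1≤logConstant 1≤b) 1≤b) (m≤m^n (s≤s z≤n) 1≤a)))) ⟩
      q ^ (2 * b) * s ^ (3 * b) * p ^ (4 * b) * (K ^ b * n ^ a) * C ^ b
        ≡⟨ lemma (C ^ b) (q ^ (2 * b)) (s ^ (3 * b)) (p ^ (4 * b)) (K ^ b) (n ^ a) ⟩
      K ^ b * C ^ b * q ^ (2 * b) * s ^ (3 * b) * p ^ (4 * b) * n ^ a
        ≡⟨ cong (λ z → z * q ^ (2 * b) * s ^ (3 * b) * p ^ (4 * b) * n ^ a) (^-distribʳ-* K C b) ⟨
      R ∎
      where
      lemma : ∀ c x y z k n → x * y * z * (k * n) * c ≡ k * c * x * y * z * n
      lemma = solve-∀

    bound : (n ^ 9) ^ b ≤ R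
    bound with s ≤? n ^ 3 | 2 ≤? n
    ... | yes s≤n³ | yes 2≤n = main s≤n³ 2≤n
    ... | no s≰n³  | _       = cubes (begin
      n ^ 9          ≡⟨ ^-*-assoc n 3 3 ⟨
      (n ^ 3) ^ 3    ≤⟨ ^-monoˡ-≤ 3 (<⇒≤ (≰⇒> s≰n³)) ⟩
      s ^ 3          ∎)
    ... | _        | no n≱2  = cubes (begin
      n ^ 9          ≤⟨ ^-monoˡ-≤ 9 (≤-pred (≰⇒> n≱2)) ⟩
      1 ^ 9          ≤⟨ 1≤m^n 1≤s 3 ⟩
      s ^ 3          ∎)

-- Laurent series satisfy the hypotheses of both bounds.

module Configuration where

  open import Defs using (Field; FiniteField; module Laurent)
  open FiniteSums
  open BallSystems
  open LaurentSeries
  open PairBound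
  open ShiftBound
  open LogarithmBound
  open import Data.Empty using (⊥-elim)
  open import Data.Fin using (Fin; zero; suc; fromℕ<)
  open import Data.Integer as ℤ using (ℤ; +_)
  import Data.Integer.Properties as ℤ
  open import Data.List using (List; _∷_; length; lookup)
  open import Data.List.Membership.Propositional.Properties using (∈-lookup)
  open import Data.List.Relation.Unary.All as All using (All)
  open import Data.List.Relation.Unary.AllPairs using (AllPairs; _∷_)
  open import Data.List.Relation.Unary.Any as Any using (Any)
  open import Data.List.Relation.Unary.Any.Properties using (lookup-result)
  open import Data.Nat using (ℕ; suc; _*_; _^_; _≤_; _<_; _≤?_; z≤n; s≤s)
  open import Data.Nat.Logarithm using (⌊log₂_⌋)
  import Data.Nat.Properties as ℕ
  open import Data.Product using (∃; _×_; _,_; proj₁; proj₂)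
  open import Data.Sum using (_⊎_; inj₁; inj₂)
  open import Function using (_∘_; flip)
  open import Function.Bundles using (Bijection)
  import Relation.Binary.PropositionalEquality as ≡
  open ≡ using (_≡_; _≢_; refl)
  import Relation.Binary.Reasoning.Setoid as SetoidReasoning
  open import Relation.Nullary using (¬_; Dec; yes; no)
  open import Relation.Nullary.Decidable using (map′; ¬?; decidable-stable)
  open import Relation.Unary using (Decidable)

  lookup-injective : ∀ {X : Set} {_≈_ : X → X → Set} → (∀ {x y} → x ≈ y → y ≈ x) →
    ∀ {xs} → AllPairs (λ x y → ¬ (x ≈ y)) xs → ∀ {i j} → lookup xs i ≈ lookup xs j → i ≡ j
  lookup-injective sym {x ∷ xs} (p ∷ ps) {zero}  {zero}  e = refl
  lookup-injective sym {x ∷ xs} (p ∷ ps) {zero}  {suc j} e = ⊥-elim (All.lookup p (∈-lookup j) e)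
  lookup-injective sym {x ∷ xs} (p ∷ ps) {suc i} {zero}  e = ⊥-elim (All.lookup p (∈-lookup i) (sym e))
  lookup-injective sym {x ∷ xs} (p ∷ ps) {suc i} {suc j} e = ≡.cong suc (lookup-injective sym ps e)

  count⇒∃ : ∀ {X} {{_ : Finite X}} {P : X → Set} (P? : Decidable P) → 1 ≤ count P? → ∃ P
  count⇒∃ {X} P? 1≤c with x , h ← ∑-pigeonhole (λ x → 𝟙 (P? x)) 0
                                  (≡.subst (_< count P?) (≡.sym (ℕ.*-zeroʳ (card X))) 1≤c)
    = x , 𝟙≢0 (P? x) (ℕ.>⇒≢ h)

  module _ {q : ℕ} (F : FiniteField q) where

    open FiniteField F using (field′; enumeration)
    private module En = Bijection enumeration
    open Field field′ hiding (refl) renaming (_≈_ to _≈F_; _*_ to _*F_)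
    private
      module F = Field field′
      module L = Laurent field′
    open Laurent field′ using (LS; coeff)

    -- Inverts the enumeration. It makes equality in the field decidable and labels the sub-balls of
    -- a ball.
    digitOf : Carrier → Fin q
    digitOf x = proj₁ (En.strictlySurjective x)

    digitOf-injective : ∀ {x y} → digitOf x ≡ digitOf y → x ≈F y
    digitOf-injective {x} {y} e = trans (sym (proj₂ (En.strictlySurjective x)))
      (trans (En.cong e) (proj₂ (En.strictlySurjective y)))

    digitOf-cong : ∀ {x y} → x ≈F y → digitOf x ≡ digitOf y
    digitOf-cong {x} {y} e = En.injective (trans (proj₂ (En.strictlySurjective x))
      (trans e (sym (proj₂ (En.strictlySurjective y)))))

    _≟F_ : ∀ x y → Dec (x ≈F y)
    x ≟F y = map′ digitOf-injective digitOf-cong (dec≡ (digitOf x) (digitOf y))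

    open Series field′ _≟F_

    module _
      {n p s : ℕ} (A : Fin n → LS) (P : Fin p → LS) (S : Fin s → LS)
      (A-inj : ∀ {i j} → A i L.≈ A j → i ≡ j)
      (S-inj : ∀ {i j} → S i L.≈ S j → i ≡ j)
      (mul : Fin n → Fin n → Fin p) (mul-spec : ∀ a b → A a L.* A b L.≈ P (mul a b))
      (sd : Fin n → Fin n → Fin n → Fin s) (sd-spec : ∀ c a a′ → A c L.+ A a L.- A a′ L.≈ S (sd c a a′))
      (2≤n : 2 ≤ n)
      (distances : ∀ i j → i ≡ j ⊎ ∃ (Distance (A i) (A j)))
      (degrees : ∀ b → (∀ i → coeff (A b) i ≈F 0#) ⊎ ∃ (Degree (A b)))
      where

      private
        module BA = BallSystem (balls A)
        module BP = BallSystem (balls P)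
        module BS = BallSystem (balls S)

        other : ∀ (i : Fin n) → ∃ λ j → j ≢ i
        other i with dec≡ (fromℕ< {0} (ℕ.≤-trans (s≤s z≤n) 2≤n)) i
        ... | no ne   = _ , ne
        ... | yes refl = fromℕ< {1} 2≤n , λ e → 1≢0 (≡.trans (≡.sym (toℕ-fromℕ< 2≤n))
                                               (≡.trans (≡.cong toℕ e) (toℕ-fromℕ< _)))
          where
          open import Data.Fin using (toℕ)
          open import Data.Fin.Properties using (toℕ-fromℕ<)
          1≢0 : 1 ≢ 0
          1≢0 ()

        -- For `i ≡ j` the value is a placeholder: `nearest` selects among the elements other than
        -- `i`.
        dist : Fin n → Fin n → ℤ
        dist i j with distances i j
        ... | inj₁ _       = + 0
        ... | inj₂ (d , _) = d

        dist-spec : ∀ {i j} → j ≢ i → Distance (A i) (A j) (dist i j)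
        dist-spec {i} {j} j≢i with distances i j
        ... | inj₁ e       = ⊥-elim (j≢i (≡.sym e))
        ... | inj₂ (_ , h) = h

        nearest : ∀ i → ∃ λ j → j ≢ i × (∀ k → k ≢ i → dist i j ℤ.≤ dist i k)
        nearest i = least (λ j → ¬? (dec≡ j i)) (λ j k → dist i j ℤ.≤ dist i k)
                          (λ j k → ℤ.≤-total (dist i j) (dist i k)) ℤ.≤-trans (other i)

        near : Fin n → Fin n
        near = proj₁ ∘ nearest

        ρ : Fin n → ℤ
        ρ i = dist i (near i)

        near≢ : ∀ a → near a ≢ a
        near≢ a = proj₁ (proj₂ (nearest a))

        near~ : ∀ a → near a BA.~[ ρ a ] a
        near~ a = BA.~-sym {x = a} (proj₂ (dist-spec (near≢ a)))

        isolated : ∀ {a a′ r} → r ℤ.< ρ a → a′ BA.~[ r ] a → a′ ≡ a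
        isolated {a} {a′} r<ρ q with dec≡ a′ a
        ... | yes e = e
        ... | no ne = ⊥-elim (proj₁ (dist-spec ne)
          (sym (q (dist a a′) (ℤ.<-≤-trans r<ρ (proj₂ (proj₂ (nearest a)) a′ ne)))))

        NZ : Fin n → Set
        NZ b = ¬ (∀ i → coeff (A b) i ≈F 0#)

        NZ? : Decidable NZ
        NZ? b with degrees b
        ... | inj₁ z              = no (λ nz → nz z)
        ... | inj₂ (d , ≉0 , _)   = yes (λ z → ≉0 (z d))

        β : Fin n → ℤ
        β b with degrees b
        ... | inj₁ _       = + 0
        ... | inj₂ (d , _) = d

        β-spec : ∀ {b} → NZ b → Degree (A b) (β b)
        β-spec {b} nz with degrees b
        ... | inj₁ z       = ⊥-elim (nz z)
        ... | inj₂ (_ , h) = h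

        zero-unique : ∀ {b b′} → ¬ NZ b → ¬ NZ b′ → b ≡ b′
        zero-unique {b} {b′} h h′ = A-inj (λ i → trans (vanishes h i) (sym (vanishes h′ i)))
          where
          vanishes : ∀ {b} → ¬ NZ b → ∀ i → coeff (A b) i ≈F 0#
          vanishes {b} h with degrees b
          ... | inj₁ z            = z
          ... | inj₂ (d , ≉0 , _) = ⊥-elim (h (λ z → ≉0 (z d)))

        open SetoidReasoning F.setoid
        open import Algebra.Properties.Ring F.ring using (+-cancelˡ; +-cancelʳ)

        sd-coeff : ∀ c a a′ i → coeff (S (sd c a a′)) i ≈F coeff (A c) i + coeff (A a) i - coeff (A a′) i
        sd-coeff c a a′ i = begin
          coeff (S (sd c a a′)) i                            ≈⟨ sd-spec c a a′ i ⟨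
          coeff (A c L.+ A a L.- A a′) i                     ≈⟨ coeff-- (A c L.+ A a) (A a′) i ⟩
          coeff (A c L.+ A a) i - coeff (A a′) i             ≈⟨ +-congʳ (coeff-+ (A c) (A a) i) ⟩
          coeff (A c) i + coeff (A a) i - coeff (A a′) i     ∎

        cancel : ∀ {c a a′} → a′ ≈F a → c + a - a′ ≈F c
        cancel {c} {a} {a′} e = begin
          c + a - a′        ≈⟨ +-assoc c a (- a′) ⟩
          c + (a - a′)      ≈⟨ +-congˡ (≈⇒-≈0 (sym e)) ⟩
          c + 0#            ≈⟨ +-identityʳ c ⟩
          c                 ∎

        mul-scale : ∀ {a a′ b r} → NZ b → a BA.~[ r ] a′ → mul a b BP.~[ r ℤ.+ β b ] mul a′ b
        mul-scale {a} {a′} {b} {r} nz q i lt = begin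
          coeff (P (mul a b)) i      ≈⟨ mul-spec a b i ⟨
          coeff (A a L.* A b) i      ≈⟨ scale {A a} {A a′} {A b} (proj₂ (β-spec nz)) q i lt ⟩
          coeff (A a′ L.* A b) i     ≈⟨ mul-spec a′ b i ⟩
          coeff (P (mul a′ b)) i     ∎

        mul-unscale : ∀ {a a′ b r} → NZ b → mul a b BP.~[ r ℤ.+ β b ] mul a′ b → a BA.~[ r ] a′
        mul-unscale {a} {a′} {b} {r} nz q = unscale {A a} {A a′} {A b} (β-spec nz) (λ i lt → begin
          coeff (A a L.* A b) i      ≈⟨ mul-spec a b i ⟩
          coeff (P (mul a b)) i      ≈⟨ q i lt ⟩
          coeff (P (mul a′ b)) i     ≈⟨ mul-spec a′ b i ⟨
          coeff (A a′ L.* A b) i     ∎)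

        mul-≡ : ∀ {a b a₁ b₁} → mul a b ≡ mul a₁ b₁ → A a L.* A b L.≈ A a₁ L.* A b₁
        mul-≡ {a} {b} {a₁} {b₁} e i = begin
          coeff (A a L.* A b) i      ≈⟨ mul-spec a b i ⟩
          coeff (P (mul a b)) i      ≡⟨ ≡.cong (λ z → coeff (P z) i) e ⟩
          coeff (P (mul a₁ b₁)) i    ≈⟨ mul-spec a₁ b₁ i ⟨
          coeff (A a₁ L.* A b₁) i    ∎

        sd-≡ : ∀ {c a a′ c₁ a₁ a₁′} → sd c a a′ ≡ sd c₁ a₁ a₁′ → ∀ i →
          coeff (A c) i + coeff (A a) i - coeff (A a′) i ≈F coeff (A c₁) i + coeff (A a₁) i - coeff (A a₁′) i
        sd-≡ {c} {a} {a′} {c₁} {a₁} {a₁′} e i = trans (sym (sd-coeff c a a′ i))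
          (trans (reflexive (≡.cong (λ z → coeff (S z) i) e)) (sd-coeff c₁ a₁ a₁′ i))

        -- Above degree `ρ a` the difference `a - a′` vanishes, so `c + a - a′` has the coefficients
        -- of `c` there.
        sd-close : ∀ {a a′ a₁ a₁′ c c₁} → a′ BA.~[ ρ a ] a → a₁′ BA.~[ ρ a₁ ] a₁ →
                   sd c a a′ ≡ sd c₁ a₁ a₁′ → c BA.~[ ρ a ℤ.⊔ ρ a₁ ] c₁
        sd-close {a} {a′} {a₁} {a₁′} {c} {c₁} q q₁ e i lt = begin
          coeff (A c) i
            ≈⟨ cancel (q i (ℤ.≤-<-trans (ℤ.i≤i⊔j (ρ a) (ρ a₁)) lt)) ⟨
          coeff (A c) i + coeff (A a) i - coeff (A a′) i
            ≈⟨ sd-≡ e i ⟩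
          coeff (A c₁) i + coeff (A a₁) i - coeff (A a₁′) i
            ≈⟨ cancel (q₁ i (ℤ.≤-<-trans (ℤ.i≤j⊔i (ρ a) (ρ a₁)) lt)) ⟩
          coeff (A c₁) i ∎

        mul-cancelʳ : ∀ {a a₁ b} → NZ b → mul a b ≡ mul a₁ b → a ≡ a₁
        mul-cancelʳ {a} {a₁} {b} nz e = A-inj (*-cancelʳ {A a} {A a₁} {A b} (β-spec nz) (mul-≡ e))

        same-step : ∀ {c a a′ a₁ a₁′} → sd c a a′ ≡ sd c a₁ a₁′ → A a L.- A a′ L.≈ A a₁ L.- A a₁′
        same-step {c} {a} {a′} {a₁} {a₁′} e i = begin
          coeff (A a L.- A a′) i            ≈⟨ coeff-- (A a) (A a′) i ⟩
          coeff (A a) i - coeff (A a′) i    ≈⟨ +-cancelˡ (coeff (A c) i) _ _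
            (trans (sym (+-assoc _ _ _)) (trans (sd-≡ e i) (+-assoc _ _ _))) ⟩
          coeff (A a₁) i - coeff (A a₁′) i  ≈⟨ coeff-- (A a₁) (A a₁′) i ⟨
          coeff (A a₁ L.- A a₁′) i          ∎

        -- Cancelling `c` gives equal nonzero differences, which `dilate-cancel` divides out to
        -- identify `b`; then `b` itself is cancelled. The first cancellation is only double
        -- negated, but equality of indices is decidable.
        sd-inj : ∀ {a a′ a₁ a₁′ b b₁ c} → a′ ≢ a → NZ b → NZ b₁ → sd c a a′ ≡ sd c a₁ a₁′ →
                 mul a b ≡ mul a₁ b₁ → mul a′ b ≡ mul a₁′ b₁ → b ≡ b₁ × a ≡ a₁ × a′ ≡ a₁′
        sd-inj {a} {a′} {a₁} {a₁′} {b} {b₁} {c} ne nz nz₁ e m m′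
          with refl ← decidable-stable (dec≡ b b₁) (λ b≢b₁ →
                 dilate-cancel {A a} {A a′} {A a₁} {A a₁′} {A b} {A b₁} (dist-spec ne) (same-step e)
                               (mul-≡ m) (mul-≡ m′) (b≢b₁ ∘ A-inj))
          = refl , mul-cancelʳ nz m , mul-cancelʳ nz m′

        Hits : Fin n × Fin p → Fin n → Set
        Hits (b , x) a = mul a b BP.~[ ρ a ℤ.+ β b ] x

        hits? : ∀ bx → Decidable (Hits bx)
        hits? (b , x) a = BP.~-dec (mul a b) (ρ a ℤ.+ β b) x

        some-nonzero : ∃ NZ
        some-nonzero with any? NZ? | other (fromℕ< 2≤n)
        ... | yes h | _ = h
        ... | no ¬h | _ , j≢i = ⊥-elim (j≢i (zero-unique (λ nz → ¬h (_ , nz)) (λ nz → ¬h (_ , nz))))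

        maximal : ∃ λ bx → NZ (proj₁ bx) × (∀ bx′ → NZ (proj₁ bx′) → count (hits? bx′) ≤ count (hits? bx))
        maximal = least (NZ? ∘ proj₁) (λ bx bx′ → count (hits? bx′) ≤ count (hits? bx))
          (λ bx bx′ → ℕ.≤-total (count (hits? bx′)) (count (hits? bx))) (flip ℕ.≤-trans)
          (let (b , nz) = some-nonzero in (b , mul b b) , nz)

        b* : Fin n
        b* = proj₁ (proj₁ maximal)

        nz* : NZ b*
        nz* = proj₁ (proj₂ maximal)

        Q? : Decidable (Hits (proj₁ maximal))
        Q? = hits? (proj₁ maximal)

        κ : ℕ
        κ = count Q?

        lower : n * (n * n * n) ≤ κ * (p * p) * s * 256
        lower = pair-bound (balls A) (balls P) 2≤n mul sd ρ β NZ? zero-unique near near≢ near~ isolated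
          mul-scale sd-close sd-inj κ (λ {b} nz x → proj₂ (proj₂ maximal) (b , x) nz)

        -- The two dilated balls contain the same point, so `a b*` and `a′ b*` are within the larger
        -- degree of each other; the dilation is then undone.
        Q-close : ∀ {a a′} → Hits (proj₁ maximal) a → Hits (proj₁ maximal) a′ → a BA.~[ ρ a ℤ.⊔ ρ a′ ] a′
        Q-close {a} {a′} h h′ = mul-unscale nz* (λ i lt → trans
          (h i (ℤ.≤-<-trans (ℤ.+-monoˡ-≤ (β b*) (ℤ.i≤i⊔j (ρ a) (ρ a′))) lt))
          (sym (h′ i (ℤ.≤-<-trans (ℤ.+-monoˡ-≤ (β b*) (ℤ.i≤j⊔i (ρ a) (ρ a′))) lt))))

        smallest : ∃ λ u → Hits (proj₁ maximal) u × (∀ a → Hits (proj₁ maximal) a → ρ u ℤ.≤ ρ a)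
        smallest = least Q? (λ u a → ρ u ℤ.≤ ρ a) (λ u a → ℤ.≤-total (ρ u) (ρ a)) ℤ.≤-trans
          -- The maximal count is at least that for the point `b* b*`, which lies in the ball around
          -- itself, so `Q` has an element.
          (count⇒∃ Q? (ℕ.≤-trans (count>0 (hits? (b* , mul b* b*)) (λ _ _ → F.refl))
                                 (proj₂ (proj₂ maximal) (b* , mul b* b*) nz*)))

        u : Fin n
        u = proj₁ smallest

        -- Minimality of `ρ u` makes the larger radius in `Q-close` equal to `ρ a`. Together with
        -- `isolated` this puts every other `a` at distance exactly `ρ a` from `u`.
        close-to-u : ∀ {a} → Hits (proj₁ maximal) a → a BA.~[ ρ a ] u
        close-to-u {a} h = ≡.subst (λ r → a BA.~[ r ] u) (ℤ.i≥j⇒i⊔j≡i (proj₂ (proj₂ smallest) a h))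
                                   (Q-close h (proj₁ (proj₂ smallest)))

        digit : Fin n → Fin q
        digit a = digitOf (coeff (A a) (ρ a))

        -- Elements of `Q` with equal radius lie within that radius of each other. If they also
        -- share the coefficient there, they are closer than the nearest neighbour and coincide.
        digit-inj : ∀ {a a′} → Hits (proj₁ maximal) a → Hits (proj₁ maximal) a′ →
                    ρ a ≡ ρ a′ → digit a ≡ digit a′ → a ≡ a′
        digit-inj {a} {a′} h h′ e d = isolated (≡.subst (λ r → ℤ.pred (ρ a) ℤ.< r) e pred<) closer
          where
          pred< : ℤ.pred (ρ a) ℤ.< ρ a
          pred< = ℤ.i≤pred[j]⇒i<j ℤ.≤-refl
          same : a BA.~[ ρ a ] a′
          same = ≡.subst (λ r → a BA.~[ r ] a′) (ℤ.i≥j⇒i⊔j≡i (ℤ.≤-reflexive (≡.sym e))) (Q-close h h′)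
          closer : a BA.~[ ℤ.pred (ρ a) ] a′
          closer = ~-refine {A a} {A a′} {ρ a} same (trans (digitOf-injective {coeff (A a) (ρ a)} {coeff (A a′) (ρ a′)} d)
                                                           (reflexive (≡.cong (coeff (A a′)) (≡.sym e))))

        -- A relation, since `z + a - u` need not be in A + A - A for every `z`; the equation
        -- `y + u = z + a` lets the cancellation laws apply directly.
        Shift : Fin s → Fin n → Fin s → Set
        Shift z a y = ∀ i → coeff (S y) i + coeff (A u) i ≈F coeff (S z) i + coeff (A a) i

        shift-inj : ∀ {z z′ a y} → Shift z a y → Shift z′ a y → z ≡ z′
        shift-inj h h′ = S-inj (λ i → +-cancelʳ _ _ _ (trans (sym (h i)) (h′ i)))

        shift-close : ∀ {z a y} → Hits (proj₁ maximal) a → Shift z a y → z BS.~[ ρ a ] y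
        shift-close q h i lt = +-cancelʳ _ _ _ (trans (sym (h i)) (+-congˡ (sym (close-to-u q i lt))))

        shift-far : ∀ {z a y r} → Hits (proj₁ maximal) a → a ≢ u → r ℤ.< ρ a → Shift z a y → ¬ z BS.~[ r ] y
        shift-far {z} {a} {y} {r} q a≢u r<ρ h near = a≢u (≡.sym (isolated r<ρ (λ i lt →
          +-cancelˡ _ _ _ (trans (+-congʳ (near i lt)) (h i)))))

        shift-sd : ∀ {c e a} → Shift (sd c u e) a (sd c a e)
        shift-sd {c} {e} {a} i = begin
          coeff (S (sd c a e)) i + U    ≈⟨ +-congʳ (sd-coeff c a e i) ⟩
          C + A′ - E + U                ≈⟨ +-assoc _ _ _ ⟩
          C + A′ + (- E + U)            ≈⟨ +-congˡ (+-comm _ _) ⟩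
          C + A′ + (U - E)              ≈⟨ interchange _ _ _ _ ⟩
          C + U + (A′ - E)              ≈⟨ +-congˡ (+-comm _ _) ⟩
          C + U + (- E + A′)            ≈⟨ +-assoc _ _ _ ⟨
          C + U - E + A′                ≈⟨ +-congʳ (sd-coeff c u e i) ⟨
          coeff (S (sd c u e)) i + A′   ∎
          where
          open import Algebra.Properties.CommutativeSemigroup +-commutativeSemigroup using (interchange)
          C  = coeff (A c) i
          A′ = coeff (A a) i
          E  = coeff (A e) i
          U  = coeff (A u) i

        sd-comm : ∀ c a e → sd c a e ≡ sd a c e
        sd-comm c a e = S-inj (λ i → trans (sd-coeff c a e i)
          (trans (+-congʳ (+-comm _ _)) (sym (sd-coeff a c e i))))

        sd-cancel : ∀ {e e′} → sd u u e ≡ sd u u e′ → e ≡ e′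
        sd-cancel {e} {e′} eq = A-inj (λ i → -‿injective (+-cancelˡ _ _ _ (sd-≡ eq i)))
          where open import Algebra.Properties.Ring F.ring using (-‿injective)

        upper : n * (κ * κ) ≤ s * (suc ⌊log₂ s ⌋ * q * (suc ⌊log₂ s ⌋ * q)) * 16
        upper = shift-bound (balls S) ρ Q? u (proj₁ (proj₂ smallest)) digit digit-inj Shift
          shift-inj shift-close shift-far sd sd-cancel
          -- `shift-sd` exchanges the second summand, while the first stage has the new element in
          -- the first place.
          (λ {e} {a} → ≡.subst (Shift (sd u u e) a) (sd-comm u a e) shift-sd) shift-sd

      indexed-bound : n ^ 9 ≤ q ^ 2 * s ^ 3 * p ^ 4 * suc ⌊log₂ s ⌋ ^ 2 * (256 * 256 * 16)
      indexed-bound = ninth-power-bound 256 16 {n} {p} {s} {κ} {q} {suc ⌊log₂ s ⌋} lower upper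

    -- From lists of series to indexed families.

    ≈-sym : ∀ {x y} → x L.≈ y → y L.≈ x
    ≈-sym e i = sym (e i)

    enumerate : ∀ {P m} → L.HasCard P m → ∃ λ (X : Fin m → LS) →
      (∀ {i j} → X i L.≈ X j → i ≡ j) × (∀ x → P x → ∃ λ i → x L.≈ X i)
    enumerate (xs , refl , distinct , _ , cover) =
      lookup xs , lookup-injective {_≈_ = L._≈_} (λ {x} {y} → ≈-sym {x} {y}) distinct ,
      λ x h → Any.index (cover x h) , lookup-result (cover x h)

    module _ (A : List LS) (distinct : L.IsFinSet A) {m₁ m₂ : ℕ}
             (sums : L.HasCard (L.InSumDiff A) m₁) (products : L.HasCard (L.InProd A) m₂) where

      private
        elem : Fin (length A) → LS
        elem = lookup A

        sum-index : ∀ c a a′ → ∃ λ i → elem c L.+ elem a L.- elem a′ L.≈ proj₁ (enumerate sums) i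
        sum-index c a a′ = proj₂ (proj₂ (enumerate sums)) (elem c L.+ elem a L.- elem a′)
          (_ , _ , _ , ∈-lookup c , ∈-lookup a , ∈-lookup a′ , λ _ → F.refl)

        product-index : ∀ a b → ∃ λ i → elem a L.* elem b L.≈ proj₁ (enumerate products) i
        product-index a b = proj₂ (proj₂ (enumerate products)) (elem a L.* elem b)
          (_ , _ , ∈-lookup a , ∈-lookup b , λ _ → F.refl)

        elem-inj : ∀ {i j} → elem i L.≈ elem j → i ≡ j
        elem-inj = lookup-injective {_≈_ = L._≈_} (λ {x} {y} → ≈-sym {x} {y}) distinct

        some-distance : ∀ i j → ¬ ¬ (i ≡ j ⊎ ∃ (Distance (elem i) (elem j)))
        some-distance i j k = distance (elem i) (elem j) (λ e → k (inj₁ (elem-inj e))) (λ d → k (inj₂ d))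

        some-degree : ∀ b → ¬ ¬ ((∀ i → coeff (elem b) i ≈F 0#) ⊎ ∃ (Degree (elem b)))
        some-degree b k = degree (elem b) (λ z → k (inj₁ z)) (λ d → k (inj₂ d))

      sums-nonempty : 1 ≤ length A → 1 ≤ m₁
      sums-nonempty 1≤n = Fin⇒1≤ (proj₁ (sum-index a a a))
        where a = fromℕ< 1≤n

      products-nonempty : 1 ≤ length A → 1 ≤ m₂
      products-nonempty 1≤n = Fin⇒1≤ (proj₁ (product-index a a))
        where a = fromℕ< 1≤n

      -- Degrees exist only up to double negation, which the decidable conclusion absorbs.
      logarithmic-bound : 2 ≤ length A →
        length A ^ 9 ≤ q ^ 2 * m₁ ^ 3 * m₂ ^ 4 * suc ⌊log₂ m₁ ⌋ ^ 2 * (256 * 256 * 16)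
      logarithmic-bound 2≤n = decidable-stable (_ ≤? _) (λ k →
        ¬¬-∀ (λ i → ¬¬-∀ (λ j → some-distance i j)) (λ distances →
        ¬¬-∀ some-degree (λ degrees →
        k (indexed-bound elem (proj₁ (enumerate products)) (proj₁ (enumerate sums))
             elem-inj (proj₁ (proj₂ (enumerate sums)))
             (λ a b → proj₁ (product-index a b)) (λ a b → proj₂ (product-index a b))
             (λ c a a′ → proj₁ (sum-index c a a′)) (λ c a a′ → proj₂ (sum-index c a a′))
             2≤n distances degrees))))

    order-positive : 1 ≤ q
    order-positive = Fin⇒1≤ (digitOf 0#)

-- The final inequality.

open import Defs
open import Data.Nat using (ℕ; _≤_; _*_; _^_; NonZero)
open import Data.Product using (Σ; _×_)
open import Data.List using (List; length)
open import Data.Nat using (s≤s; z≤n; >-nonZero; >-nonZero⁻¹)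
open import Data.Nat.Properties using (*-mono-≤)
open import Data.Product using (_,_)
open LogarithmBound using (logConstant; 1≤logConstant; absorb-log)
open Configuration

-- Here `ε = a / b`, which suffices because every positive real exceeds such a fraction. Raising to
-- the power `b` and moving negative exponents across keeps everything in the naturals; the implied
-- constant is `c₁ / c₂` before the power is taken.
theorem1p6 : (a b : ℕ) → .{{NonZero a}} → .{{NonZero b}} →
    Σ ℕ λ c₁ → Σ ℕ λ c₂ → NonZero c₁ × NonZero c₂ ×
    ((q : ℕ) → IsPrimePower q → (F : FiniteField q) →
    (A : List (Laurent.LS (FiniteField.field′ F))) →
    Laurent.IsFinSet (FiniteField.field′ F) A →
    (m₁ m₂ : ℕ) →
    Laurent.HasCard (FiniteField.field′ F) (Laurent.InSumDiff (FiniteField.field′ F) A) m₁ →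
    Laurent.HasCard (FiniteField.field′ F) (Laurent.InProd (FiniteField.field′ F) A) m₂ →
    c₁ ^ b * length A ^ (9 * b)
    ≤ c₂ ^ b * q ^ (2 * b) * m₁ ^ (3 * b) * m₂ ^ (4 * b) * length A ^ a)
theorem1p6 a b =
  -- The constant 256 of `pair-bound` enters squared and the constant 16 of `shift-bound` once, as
  -- in `ninth-power-bound`.
  1 , logConstant b * (256 * 256 * 16) , _ ,
  >-nonZero (*-mono-≤ (1≤logConstant 1≤b) 1≤C) ,
  λ q _ F A distinct m₁ m₂ sums products →
    absorb-log 1≤a 1≤b 1≤C (order-positive F)
      (sums-nonempty F A distinct sums products) (products-nonempty F A distinct sums products)
      (logarithmic-bound F A distinct sums products)
  where
  1≤a = >-nonZero⁻¹ a
  1≤b = >-nonZero⁻¹ b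
  1≤C : 1 ≤ 256 * 256 * 16
  1≤C = s≤s z≤n
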